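{- Let $k\ge 2$ and let $H$ be a connected graph. Fix a vertex $v\in V(H)$ such that $\alpha_H(v)\leq\alpha_H(w)$ for all $w\in V(H)$. Then the minimum of $\kappa(G)$ over all trees $\mathcal{T}$ on $k$ vertices and all chains $G$ of $k$ copies of $H$ with respect to $\mathcal{T}$ is attained when $\mathcal{T}$ is a star and, for each bridge $x\sim y\in\mathcal{B}_G$, both $x$ and $y$ are the copies of the vertex $v$ in the respective copies of $H$.
   Context: All graphs are finite, simple and undirected. For a connected graph $H$ with $m_H$ edges, consider the simple random walk on $H$ (from a vertex, move to a uniformly random neighbour), with stationary distribution $\pi_j=\deg_H(j)/(2m_H)$ and mean first passage times $m_{i,j}$ from $i$ to $j$ ($i\neq j$). Kemeny's constant is $\kappa(H)=\sum_{j\neq i}\pi_jm_{i,j}$, which does not depend on the choice of the vertex $i$. The accessibility index of a vertex $v$ in $H$ is $\alpha_H(v)=\sum_{i\neq v}\pi_im_{i,v}$. For a single-vertex graph both are $0$ (empty sums). Chain: let $\mathcal{T}$ be a tree with vertex set $\{1,\dots,k\}$ and $G_1,\dots,G_k$ connected graphs (on disjoint vertex sets). A chain of $G_1,\dots,G_k$ with respect to $\mathcal{T}$ is a graph $G$ obtained from the disjoint union of $G_1,\dots,G_k$ by choosing, for each edge $i\sim j$ of $\mathcal{T}$, some vertex $v_i\in V(G_i)$ and some vertex $v_j\in V(G_j)$ and adding the edge $v_i\sim v_j$ (the choices for different edges of $\mathcal{T}$ are independent; the same vertex may be chosen several times). $\mathcal{B}_G$ is the set of the $k-1$ added edges; each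 is a bridge of $G$. Here every $G_i$ is a copy of $H$. A star on $k$ vertices is a tree having a vertex adjacent to all other vertices. -}

module Defs where

open import Algebra.Bundles using (CommutativeRing)
import Algebra.Properties.Semiring.Sum as SemiringSum
open import Data.Bool.Base using (if_then_else_)
open import Data.Fin.Base as Fin using (Fin; toℕ; remQuot)
import Data.Fin.Properties as Fin
open import Data.Integer.Base using (+_)
open import Data.List.Base using (List; []; _∷_; _∷ʳ_)
open import Data.List.Relation.Unary.Linked using (Linked)
open import Data.List.Relation.Unary.Unique.Propositional using (Unique)
open import Data.Nat.Base as ℕ using (ℕ; zero; suc)
import Data.Nat.Properties as ℕ
open import Data.Product.Base using (_×_; _,_; ∃-syntax; proj₁; proj₂)
open import Data.Rational.Base using (ℚ; 0ℚ; 1ℚ; _/_; _+_; _*_; _-_; ∣_∣; _<_)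
import Data.Rational.Properties as ℚ
open import Data.Sum.Base using (_⊎_; inj₁; inj₂)
open import Level using (0ℓ)
open import Relation.Binary.Core using (Rel)
open import Relation.Binary.Construct.Closure.ReflexiveTransitive using (Star)
open import Relation.Binary.Definitions using (Decidable; Symmetric; Irreflexive)
open import Relation.Binary.PropositionalEquality using (_≡_; _≢_; refl; sym)
open import Relation.Nullary.Decidable using (does; _×-dec_; _⊎-dec_)
open import Relation.Nullary.Negation using (¬_)

open SemiringSum ℕ.+-*-semiring using () renaming (sum to sumℕ) public
open SemiringSum (CommutativeRing.semiring ℚ.+-*-commutativeRing) using (sum) public

------------------------------------------------------------------------
-- Graphs

record Graph (n : ℕ) : Set₁ where
  field
    Adj        : Rel (Fin n) 0ℓ
    adj?       : Decidable Adj
    adj-sym    : Symmetric Adj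
    adj-irrefl : Irreflexive _≡_ Adj

open Graph public

-- The graph on zero vertices satisfies this vacuously.
Connected : ∀ {n} → Graph n → Set
Connected G = ∀ u v → Star (Adj G) u v

-- A cycle is a closed walk x , y , z , … , x through at least three
-- vertices, no vertex being repeated except for the return to x.
Acyclic : ∀ {n} → Graph n → Set
Acyclic G = ∀ x y z zs →
  Unique (x ∷ y ∷ z ∷ zs) → ¬ Linked (Adj G) ((x ∷ y ∷ z ∷ zs) ∷ʳ x)

IsTree : ∀ {n} → Graph n → Set
IsTree G = Connected G × Acyclic G

HasUniversalVertex : ∀ {n} → Graph n → Set
HasUniversalVertex G = ∃[ c ] (∀ u → u ≢ c → Adj G c u)

IsStarTree : ∀ {n} → Graph n → Set
IsStarTree G = IsTree G × HasUniversalVertex G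

deg : ∀ {n} → Graph n → Fin n → ℕ
deg G u = sumℕ (λ w → if does (adj? G u w) then 1 else 0)

-- Each edge {u , w} is counted once, as the pair with u < w.
edges : ∀ {n} → Graph n → ℕ
edges G = sumℕ λ u → sumℕ λ w →
  if does ((u Fin.<? w) ×-dec adj? G u w) then 1 else 0

------------------------------------------------------------------------
-- Simple random walk

-- Division of naturals in ℚ, with a ÷ 0 = 0.  In a connected graph a zero
-- denominator occurs below only when the graph has a single vertex, where
-- κ and α are empty sums.
_÷_ : ℕ → ℕ → ℚ
a ÷ zero  = 0ℚ
a ÷ suc b = + a / suc b

transition : ∀ {n} → Graph n → Fin n → Fin n → ℚ
transition G i j = if does (adj? G i j) then 1 ÷ deg G i else 0ℚ

stationary : ∀ {n} → Graph n → Fin n → ℚ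
stationary G j = deg G j ÷ (2 ℕ.* edges G)

-- The probability that the walk started at i visits j at time t and not
-- earlier, computed by conditioning on the first step.
firstPassage : ∀ {n} → Graph n → ℕ → Fin n → Fin n → ℚ
firstPassage G zero    i j = if does (i Fin.≟ j) then 1ℚ else 0ℚ
firstPassage G (suc t) i j =
  if does (i Fin.≟ j) then 0ℚ
  else sum (λ l → transition G i l * firstPassage G t l j)

infix 4 _⟶_

_⟶_ : (ℕ → ℚ) → ℚ → Set
s ⟶ a = ∀ ε → 0ℚ < ε → ∃[ N ] (∀ M → N ℕ.≤ M → ∣ s M - a ∣ < ε)

-- The mean first passage time Σₜ t · P(T = t) is an infinite series.  Its
-- value in a finite connected graph is a unique rational number, so the
-- matrix of these times is carried as data determined by its limit
-- property; its diagonal is unconstrained and never used.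
record MeanFirstPassage {n} (G : Graph n) : Set where
  field
    time      : Fin n → Fin n → ℚ
    time-mean : ∀ {i j} → i ≢ j →
      (λ M → sum {M} λ t → (toℕ t ÷ 1) * firstPassage G (toℕ t) i j) ⟶ time i j

open MeanFirstPassage public

-- Σ_{j ≠ i} f j
sumExcept : ∀ {n} → Fin n → (Fin n → ℚ) → ℚ
sumExcept i f = sum (λ j → if does (j Fin.≟ i) then 0ℚ else f j)

-- The value of Kemeny's constant computed from the starting vertex i.
kemeny : ∀ {n} (G : Graph n) → MeanFirstPassage G → Fin n → ℚ
kemeny G m i = sumExcept i (λ j → stationary G j * time m i j)

accessibility : ∀ {n} (G : Graph n) → MeanFirstPassage G → Fin n → ℚ
accessibility G m v = sumExcept v (λ i → stationary G i * time m i v)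

------------------------------------------------------------------------
-- Chains of k copies of H

-- For an edge i ∼ j of the tree, e i j is the vertex of copy i, and e j i
-- the vertex of copy j, at which the bridge is attached.  Values of e at
-- non-edges are irrelevant.
Attachment : ℕ → ℕ → Set
Attachment k n = Fin k → Fin k → Fin n

-- (i , x) stands for the copy of the vertex x in the i-th copy of H.
SameCopy : ∀ {n} k → Graph n → Rel (Fin k × Fin n) 0ℓ
SameCopy k H (i , x) (j , y) = i ≡ j × Adj H x y

Bridge : ∀ {k n} → Graph k → Attachment k n → Rel (Fin k × Fin n) 0ℓ
Bridge T e (i , x) (j , y) = Adj T i j × x ≡ e i j × y ≡ e j i

-- The vertices Fin (k * n) are identified with Fin k × Fin n by remQuot.
chain : ∀ {k n} → Graph k → Attachment k n → Graph n → Graph (k ℕ.* n)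
chain {k} {n} T e H = record
  { Adj        = λ p q → SameCopy k H (at p) (at q) ⊎ Bridge T e (at p) (at q)
  ; adj?       = λ p q → let (i , x) = at p ; (j , y) = at q in
      ((i Fin.≟ j) ×-dec adj? H x y)
      ⊎-dec (adj? T i j ×-dec (x Fin.≟ e i j) ×-dec (y Fin.≟ e j i))
  ; adj-sym    = λ
      { (inj₁ (i≡j , xy))     → inj₁ (sym i≡j , adj-sym H xy)
      ; (inj₂ (ij , xe , ye)) → inj₂ (adj-sym T ij , ye , xe) }
  ; adj-irrefl = λ
      { refl (inj₁ (_ , xx)) → adj-irrefl H refl xx
      ; refl (inj₂ (ii , _)) → adj-irrefl T refl ii }
  }
  where
  at : Fin (k ℕ.* n) → Fin k × Fin n
  at = remQuot n

{-# OPTIONS --safe #-}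

-- Call R an effective resistance of H if R is symmetric, vanishes on the
-- diagonal and L R(·,y) = c - 2δ_y for the Laplacian L and a vector c not
-- depending on y.  With the degree vector d, put e(y) = Σ_x d_x R(x,y) and
-- W = Σ_y d_y e(y).  By uniqueness of harmonic functions the mean first passage
-- times are determined by R, which gives κ = W / 2 vol and e = α + const, so a
-- vertex minimises α exactly when it minimises e.
--
-- When two graphs are joined by a bridge p₀ ∼ q₀, the resistance between p and
-- q on different sides is R₁(p,p₀) + 1 + R₂(q₀,q), so e and W of the union
-- are explicit, increasing functions of e₁(p₀), e₂(q₀), W₁, W₂ and of the volumes.
-- Growing the tree one leaf at a time, every step adds a copy of H; each summand
-- is bounded below by its value when both ends of the bridge have minimal e, and
-- for the star grown from its centre with all bridges at v every bound is attained.
module Submission where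

open import Defs
open import Algebra.Bundles using (CommutativeRing)
import Algebra.Properties.Semiring.Sum as SemiringSum
open import Data.Bool.Base using (if_then_else_)
open import Data.Empty using (⊥-elim)
open import Data.Fin.Base as Fin using (Fin; zero; suc; toℕ; combine; remQuot)
import Data.Fin.Properties as Fin
import Data.Integer.Base as ℤ
import Data.Integer.Properties as ℤ
open import Data.List.Base using (List; []; _∷_; _++_; _∷ʳ_; tabulate; allFin; length)
open import Data.List.Membership.Propositional using (_∈_; _∉_)
import Data.List.Membership.DecPropositional as DecMembership
open import Data.List.Membership.Propositional.Properties
  using (∈-++⁺ˡ; ∈-++⁺ʳ; ∈-++⁻; ∈-tabulate⁺; ∈-tabulate⁻; ∈-allFin)
open import Data.List.Membership.Propositional.Properties.WithK using (unique∧set⇒bag)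
import Data.List.Properties as List
open import Data.List.Relation.Binary.BagAndSetEquality using (∼bag⇒↭)
open import Data.List.Relation.Binary.Permutation.Propositional using (_↭_; refl; prep; swap; trans)
open import Data.List.Relation.Binary.Permutation.Propositional.Properties using (↭-length)
open import Data.List.Relation.Unary.All as All using ([]; _∷_)
open import Data.List.Relation.Unary.AllPairs using ([]; _∷_)
open import Data.List.Relation.Unary.Any using (here; there)
open import Data.List.Relation.Unary.Linked using (Linked; [-]; _∷_)
open import Data.List.Relation.Unary.Unique.Propositional using (Unique)
import Data.List.Relation.Unary.Unique.Propositional.Properties as Unique
open import Data.Maybe.Base using (Maybe; just; nothing)
open import Data.Nat.Base as ℕ using (ℕ; zero; suc)
import Data.Nat.Properties as ℕ
open import Data.Product.Base using (_×_; _,_; proj₁; proj₂; ∃-syntax)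
open import Data.Rational.Base hiding (_÷_)
open import Data.Rational.Properties as ℚ using (module ≤-Reasoning)
import Data.Rational.Unnormalised.Base as ℚᵘ
import Data.Rational.Unnormalised.Properties as ℚᵘ
open import Data.Sum.Base using (_⊎_; inj₁; inj₂)
open import Function.Base using (_∘_; id; const)
open import Function.Bundles using (mk⇔)
open import Level using (0ℓ)
open import Relation.Binary.Bundles using (DecTotalOrder)
open import Data.List.Extrema (DecTotalOrder.totalOrder ℚ.≤-decTotalOrder) using (argmax; f[xs]≤f[argmax])
open import Relation.Binary.Construct.Closure.ReflexiveTransitive as Star
  using (Star; _◅_; _◅◅_) renaming (ε to stop)
open import Relation.Binary.Definitions using (tri<; tri≈; tri>)
open import Relation.Binary.PropositionalEquality as ≡
  using (_≡_; _≢_; refl; sym; cong; cong₂; subst; subst₂; module ≡-Reasoning)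
open import Relation.Nullary using (Dec; yes; no; ¬_; contradiction)
open import Relation.Nullary.Decidable using (does; dec-true; dec-false; does-⇔; _×-dec_)
open import Tactic.RingSolver using (solve-∀)
open import Tactic.RingSolver.Core.AlmostCommutativeRing using (AlmostCommutativeRing; fromCommutativeRing)

-- Passage times of a chain do not restrict to its copies, since the walk may leave a copy and
-- return. Resistances do, because distinct copies communicate only through bridges. The vector `c`
-- makes the gluing purely algebraic. Summing the Laplacian equation over the vertices shows that
-- `c` has total 2; joining two graphs lowers `c` by 1 at each end of the bridge, so each side
-- injects one unit and exactly one unit crosses the bridge towards the side of y. Hence `c` stays
-- independent of y. No Laplacian has to be inverted: for H the resistance is obtained from the
-- given passage times, as a commute time, and for a chain by gluing. The star appears for the
-- following reason. A new copy attached at q₀ raises the eccentricity of an old vertex q by a fixed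
-- amount plus a positive multiple of the resistance between q₀ and q. The extra term vanishes at q
-- = q₀, so a vertex of minimal eccentricity stays on the lower bound when all later copies are
-- attached to that same vertex. Volumes depend only on the number of copies, so the bounds are the
-- same for all trees.

private
  module Σ = SemiringSum (CommutativeRing.semiring ℚ.+-*-commutativeRing)

private variable
  U U′ : Set
  k n : ℕ
  xs ys : List U
  f g : U → ℚ

ℚ-ring : AlmostCommutativeRing 0ℓ 0ℓ
ℚ-ring = fromCommutativeRing ℚ.+-*-commutativeRing 0≟
  where
  0≟ : ∀ x → Maybe (0ℚ ≡ x)
  0≟ x with 0ℚ ℚ.≟ x
  ... | yes p = just p
  ... | no  _ = nothing

infix 8 2*_

2*_ : ℚ → ℚ
2* x = x + x

-- Rationals

*-nonNeg : ∀ {a b} → 0ℚ ≤ a → 0ℚ ≤ b → 0ℚ ≤ a * b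
*-nonNeg {a} {b} 0≤a 0≤b =
  subst (_≤ a * b) (ℚ.*-zeroʳ a) (ℚ.*-monoˡ-≤-nonNeg a {{nonNegative 0≤a}} 0≤b)

+-nonNeg : ∀ {a b} → 0ℚ ≤ a → 0ℚ ≤ b → 0ℚ ≤ a + b
+-nonNeg = ℚ.+-mono-≤

*-monoˡ : ∀ {a b c} → 0ℚ ≤ a → b ≤ c → a * b ≤ a * c
*-monoˡ {a} 0≤a b≤c = ℚ.*-monoˡ-≤-nonNeg a {{nonNegative 0≤a}} b≤c

0≤1 : 0ℚ ≤ 1ℚ
0≤1 = ℚ.nonNegative⁻¹ 1ℚ

a≤b⇒0≤b-a : ∀ {a b} → a ≤ b → 0ℚ ≤ b - a
a≤b⇒0≤b-a {a} {b} a≤b = subst (_≤ b - a) (ℚ.+-inverseʳ a) (ℚ.+-monoˡ-≤ (- a) a≤b)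

b-a+a≡b : ∀ a b → b - a + a ≡ b
b-a+a≡b = solve-∀ ℚ-ring

0≤b-a⇒a≤b : ∀ {a b} → 0ℚ ≤ b - a → a ≤ b
0≤b-a⇒a≤b {a} {b} p = subst₂ _≤_ (ℚ.+-identityˡ a) (b-a+a≡b a b) (ℚ.+-monoˡ-≤ a p)

b-a≡0⇒b≡a : ∀ {a b} → b - a ≡ 0ℚ → b ≡ a
b-a≡0⇒b≡a {a} {b} e =
  ≡.trans (sym (b-a+a≡b a b)) (≡.trans (cong (_+ a) e) (ℚ.+-identityˡ a))

𝟙 : {P : Set} → Dec P → ℚ
𝟙 d = if does d then 1ℚ else 0ℚ

𝟙-yes : ∀ {P : Set} (d : Dec P) → P → 𝟙 d ≡ 1ℚ
𝟙-yes d p rewrite dec-true d p = refl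

𝟙-no : ∀ {P : Set} (d : Dec P) → ¬ P → 𝟙 d ≡ 0ℚ
𝟙-no d ¬p rewrite dec-false d ¬p = refl

0≤𝟙 : ∀ {P : Set} (d : Dec P) → 0ℚ ≤ 𝟙 d
0≤𝟙 (yes _) = 0≤1
0≤𝟙 (no  _) = ℚ.≤-refl

-- Sums over lists

infix 9 ∑-syntax

∑ : List U → (U → ℚ) → ℚ
∑ []       f = 0ℚ
∑ (x ∷ xs) f = f x + ∑ xs f

∑-syntax : List U → (U → ℚ) → ℚ
∑-syntax = ∑

syntax ∑-syntax xs (λ p → e) = ∑[ p ∈ xs ] e

∑-cong : (∀ {p} → p ∈ xs → f p ≡ g p) → ∑ xs f ≡ ∑ xs g
∑-cong {xs = []}     h = refl
∑-cong {xs = x ∷ xs} h = cong₂ _+_ (h (here refl)) (∑-cong (h ∘ there))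

∑-+ : ∀ (xs : List U) (f g : U → ℚ) → ∑[ p ∈ xs ] (f p + g p) ≡ ∑ xs f + ∑ xs g
∑-+ []       f g = refl
∑-+ (x ∷ xs) f g = ≡.trans (cong (f x + g x +_) (∑-+ xs f g)) (interchange (f x) (g x) _ _)
  where
  interchange : ∀ a b c d → a + b + (c + d) ≡ a + c + (b + d)
  interchange = solve-∀ ℚ-ring

∑-* : ∀ (xs : List U) c (f : U → ℚ) → ∑[ p ∈ xs ] (c * f p) ≡ c * ∑ xs f
∑-* []       c f = sym (ℚ.*-zeroʳ c)
∑-* (x ∷ xs) c f =
  ≡.trans (cong (c * f x +_) (∑-* xs c f)) (sym (ℚ.*-distribˡ-+ c (f x) (∑ xs f)))

∑-*ʳ : ∀ (xs : List U) c (f : U → ℚ) → ∑[ p ∈ xs ] (f p * c) ≡ ∑ xs f * c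
∑-*ʳ xs c f =
  ≡.trans (∑-cong {xs = xs} (λ {p} _ → ℚ.*-comm (f p) c)) (≡.trans (∑-* xs c f) (ℚ.*-comm c (∑ xs f)))

∑-- : ∀ (xs : List U) (f g : U → ℚ) → ∑[ p ∈ xs ] (f p - g p) ≡ ∑ xs f - ∑ xs g
∑-- xs f g = begin
  ∑[ p ∈ xs ] (f p - g p)                ≡⟨ ∑-cong {xs = xs} (λ {p} _ → minus (f p) (g p)) ⟩
  ∑[ p ∈ xs ] (f p + (- 1ℚ) * g p)       ≡⟨ ∑-+ xs f (λ p → (- 1ℚ) * g p) ⟩
  ∑ xs f + ∑[ p ∈ xs ] ((- 1ℚ) * g p)    ≡⟨ cong (∑ xs f +_) (∑-* xs (- 1ℚ) g) ⟩
  ∑ xs f + (- 1ℚ) * ∑ xs g               ≡⟨ sym (minus (∑ xs f) (∑ xs g)) ⟩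
  ∑ xs f - ∑ xs g                        ∎
  where
  open ≡-Reasoning
  minus : ∀ a b → a - b ≡ a + (- 1ℚ) * b
  minus = solve-∀ ℚ-ring

∑-0 : ∀ (xs : List U) → ∑[ _ ∈ xs ] 0ℚ ≡ 0ℚ
∑-0 []       = refl
∑-0 (x ∷ xs) = ≡.trans (ℚ.+-identityˡ _) (∑-0 xs)

∑-zero : (∀ {p} → p ∈ xs → f p ≡ 0ℚ) → ∑ xs f ≡ 0ℚ
∑-zero {xs = xs} h = ≡.trans (∑-cong h) (∑-0 xs)

∑-++ : ∀ (xs ys : List U) (f : U → ℚ) → ∑ (xs ++ ys) f ≡ ∑ xs f + ∑ ys f
∑-++ []       ys f = sym (ℚ.+-identityˡ _)
∑-++ (x ∷ xs) ys f = ≡.trans (cong (f x +_) (∑-++ xs ys f)) (sym (ℚ.+-assoc (f x) _ _))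

∑-comm : ∀ (xs : List U) (ys : List U′) (f : U → U′ → ℚ) →
  ∑[ p ∈ xs ] ∑[ q ∈ ys ] f p q ≡ ∑[ q ∈ ys ] ∑[ p ∈ xs ] f p q
∑-comm []       ys f = sym (∑-0 ys)
∑-comm (x ∷ xs) ys f =
  ≡.trans (cong (∑ ys (f x) +_) (∑-comm xs ys f)) (sym (∑-+ ys (f x) _))

∑-tabulate : ∀ (h : Fin n → U) (f : U → ℚ) → ∑ (tabulate h) f ≡ sum (f ∘ h)
∑-tabulate {n = zero}  h f = refl
∑-tabulate {n = suc n} h f = cong (f (h zero) +_) (∑-tabulate (h ∘ suc) f)

∑-↭ : xs ↭ ys → (f : U → ℚ) → ∑ xs f ≡ ∑ ys f
∑-↭ refl               f = refl
∑-↭ (prep x xs↭ys)     f = cong (f x +_) (∑-↭ xs↭ys f)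
∑-↭ (swap x y xs↭ys)   f =
  ≡.trans (cong (λ s → f x + (f y + s)) (∑-↭ xs↭ys f)) (left-comm (f x) (f y) _)
  where
  left-comm : ∀ a b c → a + (b + c) ≡ b + (a + c)
  left-comm = solve-∀ ℚ-ring
∑-↭ (trans xs↭ys ys↭zs) f = ≡.trans (∑-↭ xs↭ys f) (∑-↭ ys↭zs f)

∑-nonNeg : (∀ {p} → p ∈ xs → 0ℚ ≤ f p) → 0ℚ ≤ ∑ xs f
∑-nonNeg {xs = []}     h = ℚ.≤-refl
∑-nonNeg {xs = x ∷ xs} h = +-nonNeg (h (here refl)) (∑-nonNeg (h ∘ there))

term≤∑ : ∀ {x} → (∀ {p} → p ∈ xs → 0ℚ ≤ f p) → x ∈ xs → f x ≤ ∑ xs f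
term≤∑ {xs = x ∷ xs} {f = f} h (here refl) =
  subst (_≤ f x + ∑ xs f) (ℚ.+-identityʳ (f x)) (ℚ.+-monoʳ-≤ (f x) (∑-nonNeg (h ∘ there)))
term≤∑ {xs = y ∷ xs} {f = f} {x} h (there x∈xs) =
  subst (_≤ f y + ∑ xs f) (ℚ.+-identityˡ (f x)) (ℚ.+-mono-≤ (h (here refl)) (term≤∑ (h ∘ there) x∈xs))

-- Kronecker deltas

δ : Fin n → Fin n → ℚ
δ p q = 𝟙 (p Fin.≟ q)

δ-diag : ∀ (p : Fin n) → δ p p ≡ 1ℚ
δ-diag p = 𝟙-yes (p Fin.≟ p) refl

δ-off : ∀ {p q : Fin n} → p ≢ q → δ p q ≡ 0ℚ
δ-off {p = p} {q} = 𝟙-no (p Fin.≟ q)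

δ-sym : ∀ (p q : Fin n) → δ p q ≡ δ q p
δ-sym p q with p Fin.≟ q
... | yes refl = sym (δ-diag p)
... | no  p≢q  = sym (δ-off (p≢q ∘ sym))

δ-subst : ∀ (f : Fin n → ℚ) p q → δ p q * f p ≡ δ p q * f q
δ-subst f p q with p Fin.≟ q
... | yes refl = refl
... | no  _    = ≡.trans (ℚ.*-zeroˡ (f p)) (sym (ℚ.*-zeroˡ (f q)))

∑-δ : ∀ {xs : List (Fin n)} {q} → Unique xs → q ∈ xs → (f : Fin n → ℚ) →
  ∑[ p ∈ xs ] (δ p q * f p) ≡ f q
∑-δ {xs = x ∷ xs} (x∉xs ∷ _) (here refl) f = begin
  δ x x * f x + ∑[ p ∈ xs ] (δ p x * f p)
    ≡⟨ cong₂ (λ a b → a * f x + b) (δ-diag x) (∑-zero λ {p} p∈xs →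
         ≡.trans (cong (_* f p) (δ-off (All.lookup x∉xs p∈xs ∘ sym))) (ℚ.*-zeroˡ (f p))) ⟩
  1ℚ * f x + 0ℚ
    ≡⟨ ≡.trans (ℚ.+-identityʳ _) (ℚ.*-identityˡ (f x)) ⟩
  f x ∎
  where open ≡-Reasoning
∑-δ {xs = x ∷ xs} {q} (x∉xs ∷ u) (there q∈xs) f = begin
  δ x q * f x + ∑[ p ∈ xs ] (δ p q * f p)
    ≡⟨ cong₂ (λ a b → a * f x + b) (δ-off (All.lookup x∉xs q∈xs)) (∑-δ u q∈xs f) ⟩
  0ℚ * f x + f q
    ≡⟨ ≡.trans (cong (_+ f q) (ℚ.*-zeroˡ (f x))) (ℚ.+-identityˡ (f q)) ⟩
  f q ∎
  where open ≡-Reasoning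

∑-δ₁ : ∀ {xs : List (Fin n)} {q} → Unique xs → q ∈ xs → ∑[ p ∈ xs ] δ p q ≡ 1ℚ
∑-δ₁ {xs = xs} {q} u q∈xs =
  ≡.trans (∑-cong {xs = xs} λ {p} _ → sym (ℚ.*-identityʳ (δ p q))) (∑-δ u q∈xs (const 1ℚ))

-- Effective resistance

Weight : ℕ → Set
Weight n = Fin n → Fin n → ℚ

-- The Laplacian of the subgraph induced on `xs`. Each stage of a growing chain is a list of
-- vertices of the final chain with unchanged weights, so adding a copy never changes the vertex
-- type.
lap : Weight n → List (Fin n) → (Fin n → ℚ) → Fin n → ℚ
lap w xs f p = ∑[ l ∈ xs ] (w p l * (f p - f l))

degree : Weight n → List (Fin n) → Fin n → ℚ
degree w xs p = ∑ xs (w p)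

volume : Weight n → List (Fin n) → ℚ
volume w xs = ∑ xs (degree w xs)

-- R · y is the potential of the flow that injects `current` , the same for every
-- y , and extracts 2 at y ; this characterises effective resistance.
record IsResistance (w : Weight n) (xs : List (Fin n)) (R : Weight n) : Set where
  field
    current   : Fin n → ℚ
    symmetric : ∀ p q → R p q ≡ R q p
    diagonal  : ∀ p → R p p ≡ 0ℚ
    0≤R       : ∀ p q → 0ℚ ≤ R p q
    kirchhoff : ∀ {p q} → p ∈ xs → q ∈ xs →
      lap w xs (λ l → R l q) p ≡ current p - 2* δ p q

eccentricity : Weight n → List (Fin n) → Weight n → Fin n → ℚ
eccentricity w xs R q = ∑[ p ∈ xs ] (degree w xs p * R p q)

energy : Weight n → List (Fin n) → Weight n → ℚ
energy w xs R = ∑[ q ∈ xs ] (degree w xs q * eccentricity w xs R q)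

-- Joining two graphs by a bridge

record Bridged (w : Weight n) (xs ys : List (Fin n)) (p₀ q₀ : Fin n) : Set where
  field
    unique-x : Unique xs
    unique-y : Unique ys
    p₀∈xs    : p₀ ∈ xs
    q₀∈ys    : q₀ ∈ ys
    disjoint : ∀ {p} → p ∈ xs → p ∉ ys
    cross    : ∀ {p q} → p ∈ xs → q ∈ ys → w p q ≡ δ p p₀ * δ q q₀
    cross′   : ∀ {p q} → p ∈ xs → q ∈ ys → w q p ≡ δ q q₀ * δ p p₀

-- Carrying both `cross` and `cross′` makes the situation invariant under exchange of the sides
-- without assuming `w` symmetric. Each computation is therefore done for `xs` only and transported
-- to `ys`.
swapᵇ : ∀ {w : Weight n} {xs ys p₀ q₀} → Bridged w xs ys p₀ q₀ → Bridged w ys xs q₀ p₀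
swapᵇ b = record
  { unique-x = unique-y ; unique-y = unique-x ; p₀∈xs = q₀∈ys ; q₀∈ys = p₀∈xs
  ; disjoint = λ q∈ys q∈xs → disjoint q∈xs q∈ys
  ; cross = λ q∈ys p∈xs → cross′ p∈xs q∈ys ; cross′ = λ q∈ys p∈xs → cross p∈xs q∈ys }
  where open Bridged b

-- The series law, with the bridge as a unit resistor. It is stated as equations about an arbitrary
-- `J`, not as a definition, so that exchanging the sides only permutes the fields.
record Across (xs ys : List (Fin n)) (p₀ q₀ : Fin n) (R₁ R₂ J : Weight n) : Set where
  field
    onXX : ∀ {p q} → p ∈ xs → q ∈ xs → J p q ≡ R₁ p q
    onXY : ∀ {p q} → p ∈ xs → q ∈ ys → J p q ≡ R₁ p p₀ + 1ℚ + R₂ q₀ q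
    onYX : ∀ {p q} → p ∈ ys → q ∈ xs → J p q ≡ R₂ p q₀ + 1ℚ + R₁ p₀ q
    onYY : ∀ {p q} → p ∈ ys → q ∈ ys → J p q ≡ R₂ p q

swapᵃ : ∀ {xs ys} {p₀ q₀} {R₁ R₂ J : Weight n} → Across xs ys p₀ q₀ R₁ R₂ J → Across ys xs q₀ p₀ R₂ R₁ J
swapᵃ a = record { onXX = onYY ; onXY = onYX ; onYX = onXY ; onYY = onXX }
  where open Across a

∑-affine : ∀ {A : Set} (xs : List A) (f g : A → ℚ) c → ∑[ p ∈ xs ] (f p * (g p + c)) ≡ ∑[ p ∈ xs ] (f p * g p) + ∑ xs f * c
∑-affine xs f g c = ≡.trans (∑-cong {xs = xs} λ {p} _ → ℚ.*-distribˡ-+ (f p) (g p) c)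
  (≡.trans (∑-+ xs (λ p → f p * g p) (λ p → f p * c)) (cong (∑[ p ∈ xs ] (f p * g p) +_) (∑-*ʳ xs c f)))

module HalfBridge {w : Weight n} {xs ys p₀ q₀} (b : Bridged w xs ys p₀ q₀)
  {R₁ R₂ J : Weight n} (a : Across xs ys p₀ q₀ R₁ R₂ J)
  (res₁ : IsResistance w xs R₁) (res₂ : IsResistance w ys R₂) where
  open Bridged b
  open Across a
  private
    module R₁ = IsResistance res₁
    module R₂ = IsResistance res₂
  open ≡-Reasoning

  ∑-cross : ∀ {p} → p ∈ xs → (f : Fin n → ℚ) → ∑[ l ∈ ys ] (w p l * f l) ≡ δ p p₀ * f q₀
  ∑-cross {p} p∈xs f = begin
    ∑[ l ∈ ys ] (w p l * f l)                  ≡⟨ ∑-cong {xs = ys} (λ {l} l∈ys →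
                                                    ≡.trans (cong (_* f l) (cross p∈xs l∈ys)) (ℚ.*-assoc (δ p p₀) (δ l q₀) (f l))) ⟩
    ∑[ l ∈ ys ] (δ p p₀ * (δ l q₀ * f l))      ≡⟨ ∑-* ys (δ p p₀) _ ⟩
    δ p p₀ * ∑[ l ∈ ys ] (δ l q₀ * f l)        ≡⟨ cong (δ p p₀ *_) (∑-δ unique-y q₀∈ys f) ⟩
    δ p p₀ * f q₀                              ∎

  degree-x : ∀ {p} → p ∈ xs → ∑ xs (w p) + ∑ ys (w p) ≡ degree w xs p + δ p p₀
  degree-x {p} p∈xs = cong (degree w xs p +_) (begin
    ∑ ys (w p)                 ≡⟨ ∑-cong {xs = ys} (λ {l} _ → sym (ℚ.*-identityʳ (w p l))) ⟩
    ∑[ l ∈ ys ] (w p l * 1ℚ)   ≡⟨ ∑-cross p∈xs (const 1ℚ) ⟩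
    δ p p₀ * 1ℚ                ≡⟨ ℚ.*-identityʳ _ ⟩
    δ p p₀                     ∎)

  -- Inside `xs` nothing changes except at `p₀`, where the bridge contributes
  -- `J p₀ q - J q₀ q = -1`.
  kirchhoff-xx : ∀ {p q} → p ∈ xs → q ∈ xs →
    lap w xs (λ l → J l q) p + lap w ys (λ l → J l q) p ≡ R₁.current p - δ p p₀ - 2* δ p q
  kirchhoff-xx {p} {q} p∈xs q∈xs = begin
    lap w xs (λ l → J l q) p + lap w ys (λ l → J l q) p
      ≡⟨ cong₂ _+_
           (∑-cong {xs = xs} λ l∈xs → cong (w p _ *_) (cong₂ _-_ (onXX p∈xs q∈xs) (onXX l∈xs q∈xs)))
           (∑-cross p∈xs (λ l → J p q - J l q)) ⟩
    lap w xs (λ l → R₁ l q) p + δ p p₀ * (J p q - J q₀ q)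
      ≡⟨ cong₂ (λ r s → r + δ p p₀ * s) (R₁.kirchhoff p∈xs q∈xs)
           (cong₂ _-_ (onXX p∈xs q∈xs)
             (≡.trans (onYX q₀∈ys q∈xs) (cong (λ r → r + 1ℚ + R₁ p₀ q) (R₂.diagonal q₀)))) ⟩
    R₁.current p - 2* δ p q + δ p p₀ * (R₁ p q - (0ℚ + 1ℚ + R₁ p₀ q))
      ≡⟨ alg₁ (R₁.current p) (δ p q) (δ p p₀) (R₁ p q) (R₁ p₀ q) ⟩
    R₁.current p - δ p p₀ - 2* δ p q + (δ p p₀ * R₁ p q - δ p p₀ * R₁ p₀ q)
      ≡⟨ cong (λ r → R₁.current p - δ p p₀ - 2* δ p q + (r - δ p p₀ * R₁ p₀ q)) (δ-subst (λ l → R₁ l q) p p₀) ⟩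
    R₁.current p - δ p p₀ - 2* δ p q + (δ p p₀ * R₁ p₀ q - δ p p₀ * R₁ p₀ q)
      ≡⟨ alg₂ (R₁.current p - δ p p₀ - 2* δ p q) (δ p p₀ * R₁ p₀ q) ⟩
    R₁.current p - δ p p₀ - 2* δ p q ∎
    where
    alg₁ : ∀ c d e r s → c - (d + d) + e * (r - (0ℚ + 1ℚ + s)) ≡ c - e - (d + d) + (e * r - e * s)
    alg₁ = solve-∀ ℚ-ring
    alg₂ : ∀ c d → c + (d - d) ≡ c
    alg₂ = solve-∀ ℚ-ring

  -- Seen from `xs`, a pole `q` beyond the bridge is a pole at `p₀` up to an additive constant,
  -- which gives `-2` there, while the bridge contributes `+1`. The result `-1` agrees with
  -- `kirchhoff-xx`, so the new current does not depend on the side of `q`.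
  kirchhoff-xy : ∀ {p q} → p ∈ xs → q ∈ ys →
    lap w xs (λ l → J l q) p + lap w ys (λ l → J l q) p ≡ R₁.current p - δ p p₀ - 2* δ p q
  kirchhoff-xy {p} {q} p∈xs q∈ys = begin
    lap w xs (λ l → J l q) p + lap w ys (λ l → J l q) p
      ≡⟨ cong₂ _+_
           (∑-cong {xs = xs} λ {l} l∈xs → cong (w p l *_)
             (≡.trans (cong₂ _-_ (onXY p∈xs q∈ys) (onXY l∈xs q∈ys)) (alg₁ (R₁ p p₀) (R₁ l p₀) (R₂ q₀ q))))
           (∑-cross p∈xs (λ l → J p q - J l q)) ⟩
    lap w xs (λ l → R₁ l p₀) p + δ p p₀ * (J p q - J q₀ q)
      ≡⟨ cong₂ (λ r s → r + δ p p₀ * s) (R₁.kirchhoff p∈xs p₀∈xs)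
           (cong₂ _-_ (onXY p∈xs q∈ys) (onYY q₀∈ys q∈ys)) ⟩
    R₁.current p - 2* δ p p₀ + δ p p₀ * (R₁ p p₀ + 1ℚ + R₂ q₀ q - R₂ q₀ q)
      ≡⟨ alg₂ (R₁.current p) (δ p p₀) (R₁ p p₀) (R₂ q₀ q) ⟩
    -- The `0ℚ` is shaped to become `δ p q`, which vanishes because `p` and `q` lie in disjoint
    -- lists.
    R₁.current p - δ p p₀ - 2* 0ℚ + δ p p₀ * R₁ p p₀
      ≡⟨ cong₂ (λ r s → R₁.current p - δ p p₀ - 2* r + s)
           (sym (δ-off {p = p} {q} λ { refl → disjoint p∈xs q∈ys }))
           (≡.trans (δ-subst (λ l → R₁ l p₀) p p₀) (≡.trans (cong (δ p p₀ *_) (R₁.diagonal p₀)) (ℚ.*-zeroʳ (δ p p₀)))) ⟩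
    R₁.current p - δ p p₀ - 2* δ p q + 0ℚ
      ≡⟨ ℚ.+-identityʳ _ ⟩
    R₁.current p - δ p p₀ - 2* δ p q ∎
    where
    alg₁ : ∀ r s t → r + 1ℚ + t - (s + 1ℚ + t) ≡ r - s
    alg₁ = solve-∀ ℚ-ring
    alg₂ : ∀ c e r s → c - (e + e) + e * (r + 1ℚ + s - s) ≡ c - e - (0ℚ + 0ℚ) + e * r
    alg₂ = solve-∀ ℚ-ring

  -- `d` is the degree in the union. It is kept abstract because this module is also used with the
  -- sides exchanged, while the degree is always the one over `xs ++ ys` in that order.
  module _ (d : Fin n → ℚ)
    (d-x : ∀ {p} → p ∈ xs → d p ≡ degree w xs p + δ p p₀)
    (d-y : ∀ {q} → q ∈ ys → d q ≡ degree w ys q + δ q q₀) where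

    private
      e₁ = eccentricity w xs R₁
      e₂ = eccentricity w ys R₂
      v₁ = volume w xs
      v₂ = volume w ys

    ∑-d-x : (f : Fin n → ℚ) → ∑[ p ∈ xs ] (d p * f p) ≡ ∑[ p ∈ xs ] (degree w xs p * f p) + f p₀
    ∑-d-x f = begin
      ∑[ p ∈ xs ] (d p * f p)
        ≡⟨ ∑-cong {xs = xs} (λ {p} p∈xs →
             ≡.trans (cong (_* f p) (d-x p∈xs)) (ℚ.*-distribʳ-+ (f p) (degree w xs p) (δ p p₀))) ⟩
      ∑[ p ∈ xs ] (degree w xs p * f p + δ p p₀ * f p)
        ≡⟨ ∑-+ xs _ _ ⟩
      ∑[ p ∈ xs ] (degree w xs p * f p) + ∑[ p ∈ xs ] (δ p p₀ * f p)
        ≡⟨ cong (∑[ p ∈ xs ] (degree w xs p * f p) +_) (∑-δ unique-x p₀∈xs f) ⟩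
      ∑[ p ∈ xs ] (degree w xs p * f p) + f p₀ ∎

    volume-x : ∑ xs d ≡ v₁ + 1ℚ
    volume-x = begin
      ∑ xs d                                  ≡⟨ ∑-cong d-x ⟩
      ∑[ p ∈ xs ] (degree w xs p + δ p p₀)    ≡⟨ ∑-+ xs _ _ ⟩
      v₁ + ∑[ p ∈ xs ] (δ p p₀)               ≡⟨ cong (v₁ +_) (∑-δ₁ unique-x p₀∈xs) ⟩
      v₁ + 1ℚ                                 ∎

    ∑-d-y-far : ∀ {q} → q ∈ xs → ∑[ p ∈ ys ] (d p * J p q) ≡ e₂ q₀ + (v₂ + 1ℚ) * (1ℚ + R₁ p₀ q)
    ∑-d-y-far {q} q∈xs = begin
      ∑[ p ∈ ys ] (d p * J p q)
        ≡⟨ ∑-cong {xs = ys} (λ {p} p∈ys → ≡.trans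
             (cong₂ _*_ (d-y p∈ys) (onYX p∈ys q∈xs))
             (alg₁ (degree w ys p) (δ p q₀) (R₂ p q₀) (R₁ p₀ q))) ⟩
      ∑[ p ∈ ys ] (degree w ys p * (R₂ p q₀ + (1ℚ + R₁ p₀ q)) + δ p q₀ * (R₂ p q₀ + (1ℚ + R₁ p₀ q)))
        ≡⟨ ∑-+ ys _ _ ⟩
      ∑[ p ∈ ys ] (degree w ys p * (R₂ p q₀ + (1ℚ + R₁ p₀ q))) + ∑[ p ∈ ys ] (δ p q₀ * (R₂ p q₀ + (1ℚ + R₁ p₀ q)))
        ≡⟨ cong₂ _+_ (∑-affine ys (degree w ys) (λ p → R₂ p q₀) (1ℚ + R₁ p₀ q))
             (≡.trans (∑-δ unique-y q₀∈ys (λ p → R₂ p q₀ + (1ℚ + R₁ p₀ q))) (cong (_+ (1ℚ + R₁ p₀ q)) (R₂.diagonal q₀))) ⟩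
      e₂ q₀ + v₂ * (1ℚ + R₁ p₀ q) + (0ℚ + (1ℚ + R₁ p₀ q))
        ≡⟨ alg₂ (e₂ q₀) v₂ (R₁ p₀ q) ⟩
      e₂ q₀ + (v₂ + 1ℚ) * (1ℚ + R₁ p₀ q) ∎
      where
      alg₁ : ∀ a b c r → (a + b) * (c + 1ℚ + r) ≡ a * (c + (1ℚ + r)) + b * (c + (1ℚ + r))
      alg₁ = solve-∀ ℚ-ring
      alg₂ : ∀ e v r → e + v * (1ℚ + r) + (0ℚ + (1ℚ + r)) ≡ e + (v + 1ℚ) * (1ℚ + r)
      alg₂ = solve-∀ ℚ-ring

    -- Every far vertex reaches `q` through `p₀`, so `R₁ p₀ q` is counted with the far volume
    -- `v₂ + 1`, bridge end included, and once more for the extra degree of `p₀`.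
    eccentricity-x : ∀ {q} → q ∈ xs → ∑[ p ∈ xs ] (d p * J p q) + ∑[ p ∈ ys ] (d p * J p q) ≡
      e₁ q + (v₂ + 2* 1ℚ) * R₁ p₀ q + (e₂ q₀ + v₂ + 1ℚ)
    eccentricity-x {q} q∈xs = begin
      ∑[ p ∈ xs ] (d p * J p q) + ∑[ p ∈ ys ] (d p * J p q)
        ≡⟨ cong₂ _+_
             (≡.trans (∑-cong {xs = xs} λ p∈xs → cong (d _ *_) (onXX p∈xs q∈xs)) (∑-d-x (λ p → R₁ p q)))
             (∑-d-y-far q∈xs) ⟩
      e₁ q + R₁ p₀ q + (e₂ q₀ + (v₂ + 1ℚ) * (1ℚ + R₁ p₀ q))
        ≡⟨ alg (e₁ q) (R₁ p₀ q) (e₂ q₀) v₂ ⟩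
      e₁ q + (v₂ + 2* 1ℚ) * R₁ p₀ q + (e₂ q₀ + v₂ + 1ℚ) ∎
      where
      alg : ∀ e r f v → e + r + (f + (v + 1ℚ) * (1ℚ + r)) ≡ e + (v + (1ℚ + 1ℚ)) * r + (f + v + 1ℚ)
      alg = solve-∀ ℚ-ring

    energy-x : ∀ (f : Fin n → ℚ) → (∀ {q} → q ∈ xs → f q ≡ e₁ q + (v₂ + 2* 1ℚ) * R₁ p₀ q + (e₂ q₀ + v₂ + 1ℚ)) →
      ∑[ q ∈ xs ] (d q * f q) ≡
      energy w xs R₁ + e₁ p₀ + (v₂ + 2* 1ℚ) * e₁ p₀ + (v₁ + 1ℚ) * (e₂ q₀ + v₂ + 1ℚ)
    energy-x f f-x = begin
      ∑[ q ∈ xs ] (d q * f q)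
        ≡⟨ ∑-cong {xs = xs} (λ q∈xs → cong (d _ *_) (f-x q∈xs)) ⟩
      ∑[ q ∈ xs ] (d q * (e₁ q + u * R₁ p₀ q + c))
        ≡⟨ ∑-affine xs d _ c ⟩
      ∑[ q ∈ xs ] (d q * (e₁ q + u * R₁ p₀ q)) + ∑ xs d * c
        ≡⟨ cong₂ (λ a b → a + b * c) (∑-d-x (λ q → e₁ q + u * R₁ p₀ q)) volume-x ⟩
      ∑[ q ∈ xs ] (degree w xs q * (e₁ q + u * R₁ p₀ q)) + (e₁ p₀ + u * R₁ p₀ p₀) + (v₁ + 1ℚ) * c
        ≡⟨ cong₂ (λ a b → a + (e₁ p₀ + u * b) + (v₁ + 1ℚ) * c) split (R₁.diagonal p₀) ⟩
      energy w xs R₁ + u * e₁ p₀ + (e₁ p₀ + u * 0ℚ) + (v₁ + 1ℚ) * c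
        ≡⟨ alg (energy w xs R₁) u (e₁ p₀) ((v₁ + 1ℚ) * c) ⟩
      energy w xs R₁ + e₁ p₀ + u * e₁ p₀ + (v₁ + 1ℚ) * c ∎
      where
      u = v₂ + 2* 1ℚ
      c = e₂ q₀ + v₂ + 1ℚ
      alg : ∀ a u e b → a + u * e + (e + u * 0ℚ) + b ≡ a + e + u * e + b
      alg = solve-∀ ℚ-ring
      alg′ : ∀ a b u r → a * (b + u * r) ≡ a * b + u * (a * r)
      alg′ = solve-∀ ℚ-ring
      split : ∑[ q ∈ xs ] (degree w xs q * (e₁ q + u * R₁ p₀ q)) ≡ energy w xs R₁ + u * e₁ p₀
      split = begin
        ∑[ q ∈ xs ] (degree w xs q * (e₁ q + u * R₁ p₀ q))
          ≡⟨ ∑-cong {xs = xs} (λ {q} _ → ≡.trans (alg′ (degree w xs q) (e₁ q) u (R₁ p₀ q))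
               (cong (λ r → degree w xs q * e₁ q + u * (degree w xs q * r)) (R₁.symmetric p₀ q))) ⟩
        ∑[ q ∈ xs ] (degree w xs q * e₁ q + u * (degree w xs q * R₁ q p₀))
          ≡⟨ ∑-+ xs _ _ ⟩
        energy w xs R₁ + ∑[ q ∈ xs ] (u * (degree w xs q * R₁ q p₀))
          ≡⟨ cong (energy w xs R₁ +_) (∑-* xs u _) ⟩
        energy w xs R₁ + u * e₁ p₀ ∎

module Bridge {w : Weight n} {xs ys p₀ q₀} (b : Bridged w xs ys p₀ q₀)
  {R₁ R₂ : Weight n} (res₁ : IsResistance w xs R₁) (res₂ : IsResistance w ys R₂) where
  open Bridged b
  open DecMembership (Fin._≟_ {n}) using (_∈?_)
  open ≡-Reasoning
  private
    module R₁ = IsResistance res₁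
    module R₂ = IsResistance res₂

    -- The membership decisions are arguments, so the global properties follow by matching on them.
    -- Outside both lists the values are arbitrary, but still symmetric, nonnegative and zero on the
    -- diagonal, as `IsResistance` asks for all vertices.
    join : ∀ p q → Dec (p ∈ xs) → Dec (q ∈ xs) → ℚ
    join p q (yes _) (yes _) = R₁ p q
    join p q (yes _) (no  _) = R₁ p p₀ + 1ℚ + R₂ q₀ q
    join p q (no  _) (yes _) = R₂ p q₀ + 1ℚ + R₁ p₀ q
    join p q (no  _) (no  _) = R₂ p q

    join-current : ∀ p → Dec (p ∈ xs) → ℚ
    join-current p (yes _) = R₁.current p - δ p p₀
    join-current p (no  _) = R₂.current p - δ p q₀

    reverse : ∀ {a b} a′ b′ → a ≡ a′ → b ≡ b′ → a + 1ℚ + b ≡ b′ + 1ℚ + a′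
    reverse a b refl refl = alg a b
      where
      alg : ∀ a b → a + 1ℚ + b ≡ b + 1ℚ + a
      alg = solve-∀ ℚ-ring

    join-sym : ∀ p q dp dq → join p q dp dq ≡ join q p dq dp
    join-sym p q (yes _) (yes _) = R₁.symmetric p q
    join-sym p q (yes _) (no  _) = reverse _ _ (R₁.symmetric p p₀) (R₂.symmetric q₀ q)
    join-sym p q (no  _) (yes _) = reverse _ _ (R₂.symmetric p q₀) (R₁.symmetric p₀ q)
    join-sym p q (no  _) (no  _) = R₂.symmetric p q

    join-diag : ∀ p d → join p p d d ≡ 0ℚ
    join-diag p (yes _) = R₁.diagonal p
    join-diag p (no  _) = R₂.diagonal p

    join-nonNeg : ∀ p q dp dq → 0ℚ ≤ join p q dp dq
    join-nonNeg p q (yes _) (yes _) = R₁.0≤R p q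
    join-nonNeg p q (yes _) (no  _) = +-nonNeg (+-nonNeg (R₁.0≤R p p₀) 0≤1) (R₂.0≤R q₀ q)
    join-nonNeg p q (no  _) (yes _) = +-nonNeg (+-nonNeg (R₂.0≤R p q₀) 0≤1) (R₁.0≤R p₀ q)
    join-nonNeg p q (no  _) (no  _) = R₂.0≤R p q

  J : Weight n
  J p q = join p q (p ∈? xs) (q ∈? xs)

  across : Across xs ys p₀ q₀ R₁ R₂ J
  across = record { onXX = xx ; onXY = xy ; onYX = yx ; onYY = yy }
    where
    xx : ∀ {p q} → p ∈ xs → q ∈ xs → J p q ≡ R₁ p q
    xx {p} {q} p∈ q∈ with p ∈? xs | q ∈? xs
    ... | yes _  | yes _  = refl
    ... | no p∉  | _      = contradiction p∈ p∉
    ... | yes _  | no q∉  = contradiction q∈ q∉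
    xy : ∀ {p q} → p ∈ xs → q ∈ ys → J p q ≡ R₁ p p₀ + 1ℚ + R₂ q₀ q
    xy {p} {q} p∈ q∈ with p ∈? xs | q ∈? xs
    ... | yes _  | no _   = refl
    ... | no p∉  | _      = contradiction p∈ p∉
    ... | yes _  | yes q∈xs = contradiction q∈ (disjoint q∈xs)
    yx : ∀ {p q} → p ∈ ys → q ∈ xs → J p q ≡ R₂ p q₀ + 1ℚ + R₁ p₀ q
    yx {p} {q} p∈ q∈ with p ∈? xs | q ∈? xs
    ... | no _   | yes _  = refl
    ... | _      | no q∉  = contradiction q∈ q∉
    ... | yes p∈xs | yes _ = contradiction p∈ (disjoint p∈xs)
    yy : ∀ {p q} → p ∈ ys → q ∈ ys → J p q ≡ R₂ p q
    yy {p} {q} p∈ q∈ with p ∈? xs | q ∈? xs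
    ... | no _   | no _  = refl
    ... | yes p∈xs | _   = contradiction p∈ (disjoint p∈xs)
    ... | no _   | yes q∈xs = contradiction q∈ (disjoint q∈xs)

  private
    module X = HalfBridge b across res₁ res₂
    module Y = HalfBridge (swapᵇ b) (swapᵃ across) res₂ res₁

    current : Fin n → ℚ
    current p = join-current p (p ∈? xs)

    current-x : ∀ {p} → p ∈ xs → current p ≡ R₁.current p - δ p p₀
    current-x {p} p∈ with p ∈? xs
    ... | yes _  = refl
    ... | no p∉  = contradiction p∈ p∉

    current-y : ∀ {p} → p ∈ ys → current p ≡ R₂.current p - δ p q₀
    current-y {p} p∈ with p ∈? xs
    ... | no _ = refl
    ... | yes p∈xs = contradiction p∈ (disjoint p∈xs)

    kirchhoff : ∀ {p q} → p ∈ xs ++ ys → q ∈ xs ++ ys →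
      lap w (xs ++ ys) (λ l → J l q) p ≡ current p - 2* δ p q
    kirchhoff {p} {q} p∈ q∈ = ≡.trans (∑-++ xs ys _) (by (∈-++⁻ xs p∈) (∈-++⁻ xs q∈))
      where
      by : p ∈ xs ⊎ p ∈ ys → q ∈ xs ⊎ q ∈ ys →
        lap w xs (λ l → J l q) p + lap w ys (λ l → J l q) p ≡ current p - 2* δ p q
      by (inj₁ px) (inj₁ qx) = ≡.trans (X.kirchhoff-xx px qx) (cong (_- 2* δ p q) (sym (current-x px)))
      by (inj₁ px) (inj₂ qy) = ≡.trans (X.kirchhoff-xy px qy) (cong (_- 2* δ p q) (sym (current-x px)))
      by (inj₂ py) (inj₁ qx) = ≡.trans (ℚ.+-comm (lap w xs (λ l → J l q) p) _)
        (≡.trans (Y.kirchhoff-xy py qx) (cong (_- 2* δ p q) (sym (current-y py))))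
      by (inj₂ py) (inj₂ qy) = ≡.trans (ℚ.+-comm (lap w xs (λ l → J l q) p) _)
        (≡.trans (Y.kirchhoff-xx py qy) (cong (_- 2* δ p q) (sym (current-y py))))

  isResistance : IsResistance w (xs ++ ys) J
  isResistance = record
    { current   = current
    ; symmetric = λ p q → join-sym p q (p ∈? xs) (q ∈? xs)
    ; diagonal  = λ p → join-diag p (p ∈? xs)
    ; 0≤R       = λ p q → join-nonNeg p q (p ∈? xs) (q ∈? xs)
    ; kirchhoff = kirchhoff }

  private
    d = degree w (xs ++ ys)
    e = eccentricity w (xs ++ ys) J
    e₁ = eccentricity w xs R₁
    e₂ = eccentricity w ys R₂
    v₁ = volume w xs
    v₂ = volume w ys

    d-x : ∀ {p} → p ∈ xs → d p ≡ degree w xs p + δ p p₀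
    d-x {p} p∈ = ≡.trans (∑-++ xs ys (w p)) (X.degree-x p∈)

    d-y : ∀ {p} → p ∈ ys → d p ≡ degree w ys p + δ p q₀
    d-y {p} p∈ = ≡.trans (∑-++ xs ys (w p)) (≡.trans (ℚ.+-comm (∑ xs (w p)) (∑ ys (w p))) (Y.degree-x p∈))

  volume-bridge : volume w (xs ++ ys) ≡ v₁ + v₂ + 2* 1ℚ
  volume-bridge = begin
    volume w (xs ++ ys)         ≡⟨ ∑-++ xs ys d ⟩
    ∑ xs d + ∑ ys d             ≡⟨ cong₂ _+_ (X.volume-x d d-x d-y) (Y.volume-x d d-y d-x) ⟩
    v₁ + 1ℚ + (v₂ + 1ℚ)         ≡⟨ alg v₁ v₂ ⟩
    v₁ + v₂ + 2* 1ℚ             ∎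
    where
    alg : ∀ a b → a + 1ℚ + (b + 1ℚ) ≡ a + b + (1ℚ + 1ℚ)
    alg = solve-∀ ℚ-ring

  eccentricity-bridgeˡ : ∀ {q} → q ∈ xs → e q ≡ e₁ q + (v₂ + 2* 1ℚ) * R₁ p₀ q + (e₂ q₀ + v₂ + 1ℚ)
  eccentricity-bridgeˡ q∈ = ≡.trans (∑-++ xs ys _) (X.eccentricity-x d d-x d-y q∈)

  eccentricity-bridgeʳ : ∀ {q} → q ∈ ys → e q ≡ e₂ q + (v₁ + 2* 1ℚ) * R₂ q₀ q + (e₁ p₀ + v₁ + 1ℚ)
  eccentricity-bridgeʳ {q} q∈ = ≡.trans (∑-++ xs ys _)
    (≡.trans (ℚ.+-comm (∑[ p ∈ xs ] (d p * J p q)) _) (Y.eccentricity-x d d-y d-x q∈))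

  -- `e₁ p₀` occurs `v₂ + 1` times for the pairs across the bridge and once for the extra degree at
  -- `p₀`; likewise `e₂ q₀`. The product `(v₁ + 1) * (v₂ + 1)` is the resistance of the bridge
  -- itself, summed over the pairs it separates. The doubling counts ordered pairs.
  energy-bridge : energy w (xs ++ ys) J ≡
    energy w xs R₁ + energy w ys R₂ +
    2* ((v₂ + 2* 1ℚ) * e₁ p₀ + (v₁ + 2* 1ℚ) * e₂ q₀ + (v₁ + 1ℚ) * (v₂ + 1ℚ))
  energy-bridge = begin
    energy w (xs ++ ys) J
      ≡⟨ ∑-++ xs ys _ ⟩
    ∑[ q ∈ xs ] (d q * e q) + ∑[ q ∈ ys ] (d q * e q)
      ≡⟨ cong₂ _+_ (X.energy-x d d-x d-y e eccentricity-bridgeˡ) (Y.energy-x d d-y d-x e eccentricity-bridgeʳ) ⟩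
    (energy w xs R₁ + e₁ p₀ + (v₂ + 2* 1ℚ) * e₁ p₀ + (v₁ + 1ℚ) * (e₂ q₀ + v₂ + 1ℚ)) +
    (energy w ys R₂ + e₂ q₀ + (v₁ + 2* 1ℚ) * e₂ q₀ + (v₂ + 1ℚ) * (e₁ p₀ + v₁ + 1ℚ))
      ≡⟨ alg (energy w xs R₁) (energy w ys R₂) (e₁ p₀) (e₂ q₀) v₁ v₂ ⟩
    energy w xs R₁ + energy w ys R₂ +
    2* ((v₂ + 2* 1ℚ) * e₁ p₀ + (v₁ + 2* 1ℚ) * e₂ q₀ + (v₁ + 1ℚ) * (v₂ + 1ℚ)) ∎
    where
    alg : ∀ W₁ W₂ a b v u →
      (W₁ + a + (u + (1ℚ + 1ℚ)) * a + (v + 1ℚ) * (b + u + 1ℚ)) +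
      (W₂ + b + (v + (1ℚ + 1ℚ)) * b + (u + 1ℚ) * (a + v + 1ℚ)) ≡
      W₁ + W₂ +
      (((u + (1ℚ + 1ℚ)) * a + (v + (1ℚ + 1ℚ)) * b + (v + 1ℚ) * (u + 1ℚ)) +
       ((u + (1ℚ + 1ℚ)) * a + (v + (1ℚ + 1ℚ)) * b + (v + 1ℚ) * (u + 1ℚ)))
    alg = solve-∀ ℚ-ring

-- Natural numbers as rationals

ι : ℕ → ℚ
ι a = a ÷ 1

private
  toℚᵘ-÷ : ∀ a b → toℚᵘ (a ÷ suc b) ℚᵘ.≃ ℚᵘ.mkℚᵘ (ℤ.+ a) b
  toℚᵘ-÷ a b = ℚ.toℚᵘ-fromℚᵘ (ℚᵘ.mkℚᵘ (ℤ.+ a) b)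

÷-ι : ∀ a b → a ÷ b ≡ ι a * (1 ÷ b)
÷-ι a zero    = sym (ℚ.*-zeroʳ (ι a))
÷-ι a (suc b) = ℚ.toℚᵘ-injective (begin
  toℚᵘ (a ÷ suc b)                         ≈⟨ toℚᵘ-÷ a b ⟩
  ℚᵘ.mkℚᵘ (ℤ.+ a) b                          ≈⟨ ℚᵘ.*≡* (cong₂ ℤ._*_ (sym (ℤ.*-identityʳ (ℤ.+ a))) (cong (ℤ.+_ ∘ suc) (ℕ.+-identityʳ b))) ⟩
  ℚᵘ.mkℚᵘ (ℤ.+ a) 0 ℚᵘ.* ℚᵘ.mkℚᵘ (ℤ.+ 1) b     ≈⟨ ℚᵘ.*-cong (toℚᵘ-÷ a 0) (toℚᵘ-÷ 1 b) ⟨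
  toℚᵘ (ι a) ℚᵘ.* toℚᵘ (1 ÷ suc b)         ≈⟨ ℚ.toℚᵘ-homo-* (ι a) (1 ÷ suc b) ⟨
  toℚᵘ (ι a * (1 ÷ suc b))                 ∎)
  where open ℚᵘ.≃-Reasoning

ι-inverse : ∀ b → ι (suc b) * (1 ÷ suc b) ≡ 1ℚ
ι-inverse b = ℚ.toℚᵘ-injective (begin
  toℚᵘ (ι (suc b) * (1 ÷ suc b))                     ≈⟨ ℚ.toℚᵘ-homo-* (ι (suc b)) (1 ÷ suc b) ⟩
  toℚᵘ (ι (suc b)) ℚᵘ.* toℚᵘ (1 ÷ suc b)             ≈⟨ ℚᵘ.*-cong (toℚᵘ-÷ (suc b) 0) (toℚᵘ-÷ 1 b) ⟩
  ℚᵘ.mkℚᵘ (ℤ.+ suc b) 0 ℚᵘ.* ℚᵘ.mkℚᵘ (ℤ.+ 1) b           ≈⟨ ℚᵘ.*≡* (cong ℤ.+_ (≡.trans (ℕ.*-identityʳ _) (≡.trans (ℕ.*-identityʳ _) (sym (≡.trans (ℕ.*-identityˡ _) (ℕ.+-identityʳ _)))))) ⟩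
  toℚᵘ 1ℚ                                            ∎)
  where open ℚᵘ.≃-Reasoning

ι-+ : ∀ a b → ι (a ℕ.+ b) ≡ ι a + ι b
ι-+ a b = ℚ.toℚᵘ-injective (begin
  toℚᵘ (ι (a ℕ.+ b))                             ≈⟨ toℚᵘ-÷ (a ℕ.+ b) 0 ⟩
  ℚᵘ.mkℚᵘ (ℤ.+ (a ℕ.+ b)) 0                        ≈⟨ ℚᵘ.*≡* (cong (ℤ._* ℤ.+ 1) (sym (cong₂ ℤ._+_ (ℤ.*-identityʳ (ℤ.+ a)) (ℤ.*-identityʳ (ℤ.+ b))))) ⟩
  ℚᵘ.mkℚᵘ (ℤ.+ a ℤ.* ℤ.+ 1 ℤ.+ ℤ.+ b ℤ.* ℤ.+ 1) 0        ≈⟨ ℚᵘ.+-cong (toℚᵘ-÷ a 0) (toℚᵘ-÷ b 0) ⟨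
  toℚᵘ (ι a) ℚᵘ.+ toℚᵘ (ι b)                     ≈⟨ ℚ.toℚᵘ-homo-+ (ι a) (ι b) ⟨
  toℚᵘ (ι a + ι b)                               ∎)
  where open ℚᵘ.≃-Reasoning

ι-injective : ∀ {a b} → ι a ≡ ι b → a ≡ b
ι-injective {a} {b} e with ℚ./-injective-≃ (ℚᵘ.mkℚᵘ (ℤ.+ a) 0) (ℚᵘ.mkℚᵘ (ℤ.+ b) 0) e
... | ℚᵘ.*≡* p = ℤ.+-injective (ℤ.*-cancelʳ-≡ (ℤ.+ a) (ℤ.+ b) (ℤ.+ 1) p)

0≤÷ : ∀ a b → 0ℚ ≤ a ÷ b
0≤÷ a zero    = ℚ.≤-refl
0≤÷ a (suc b) = ℚ.nonNegative⁻¹ (a ÷ suc b) {{ℚ.normalize-nonNeg a (suc b)}}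

ι-sum : ∀ (f : Fin n → ℕ) → ι (sumℕ f) ≡ sum (ι ∘ f)
ι-sum {zero}  f = refl
ι-sum {suc n} f = ≡.trans (ι-+ (f zero) (sumℕ (f ∘ suc))) (cong (λ s → ι (f zero) + s) (ι-sum (f ∘ suc)))

ι-if : ∀ {P : Set} (d : Dec P) → ι (if does d then 1 else 0) ≡ 𝟙 d
ι-if (yes _) = refl
ι-if (no  _) = refl

-- Limits

infix 4 _⇝_

-- Wraps _⟶_ , whose unfolding hides the sequence and the limit from unification.
record _⇝_ (s : ℕ → ℚ) (a : ℚ) : Set where
  constructor converges
  field limit : s ⟶ a

open _⇝_

⇝-cong : ∀ {s t a} → (∀ M → s M ≡ t M) → s ⇝ a → t ⇝ a
⇝-cong {a = a} s≗t (converges s⟶a) .limit ε 0<ε with s⟶a ε 0<ε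
... | N , close = N , λ M N≤M → subst (λ x → ∣ x - a ∣ < ε) (s≗t M) (close M N≤M)

⇝-const : ∀ a → (λ _ → a) ⇝ a
⇝-const a .limit ε 0<ε = 0 , λ _ _ → subst (_< ε) (sym (cong ∣_∣ (ℚ.+-inverseʳ a))) 0<ε

⇝-tail : ∀ {s a} → s ⇝ a → (s ∘ suc) ⇝ a
⇝-tail (converges s⟶a) .limit ε 0<ε with s⟶a ε 0<ε
... | N , close = N , λ M N≤M → close (suc M) (ℕ.m≤n⇒m≤1+n N≤M)

⇝-untail : ∀ {s a} → (s ∘ suc) ⇝ a → s ⇝ a
⇝-untail (converges s⟶a) .limit ε 0<ε with s⟶a ε 0<ε
... | N , close = suc N , λ { (suc M) (ℕ.s≤s N≤M) → close M N≤M }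

⇝-+ : ∀ {s t a b} → s ⇝ a → t ⇝ b → (λ M → s M + t M) ⇝ (a + b)
⇝-+ {s} {t} {a} {b} (converges s⟶a) (converges t⟶b) .limit ε 0<ε with s⟶a (½ * ε) 0<½ε | t⟶b (½ * ε) 0<½ε
  where
  0<½ε : 0ℚ < ½ * ε
  0<½ε = subst (_< ½ * ε) (ℚ.*-zeroʳ ½) (ℚ.*-monoʳ-<-pos ½ 0<ε)
... | N₁ , close₁ | N₂ , close₂ = N₁ ℕ.⊔ N₂ , λ M N≤M → begin-strict
  ∣ s M + t M - (a + b) ∣          ≡⟨ cong ∣_∣ (alg (s M) (t M) a b) ⟩
  ∣ (s M - a) + (t M - b) ∣        ≤⟨ ℚ.∣p+q∣≤∣p∣+∣q∣ (s M - a) (t M - b) ⟩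
  ∣ s M - a ∣ + ∣ t M - b ∣        <⟨ ℚ.+-mono-< (close₁ M (ℕ.m⊔n≤o⇒m≤o N₁ N₂ N≤M)) (close₂ M (ℕ.m⊔n≤o⇒n≤o N₁ N₂ N≤M)) ⟩
  ½ * ε + ½ * ε                    ≡⟨ ℚ.*-distribʳ-+ ε ½ ½ ⟨
  1ℚ * ε                           ≡⟨ ℚ.*-identityˡ ε ⟩
  ε                                ∎
  where
  open ≤-Reasoning
  alg : ∀ s t a b → s + t - (a + b) ≡ (s - a) + (t - b)
  alg = solve-∀ ℚ-ring

⇝-* : ∀ {s a} c → s ⇝ a → (λ M → c * s M) ⇝ (c * a)
⇝-* {s} {a} c (converges s⟶a) .limit ε 0<ε = proj₁ near , λ M N≤M → begin-strict
  ∣ c * s M - c * a ∣       ≡⟨ cong ∣_∣ (alg c (s M) a) ⟩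
  ∣ c * (s M - a) ∣         ≡⟨ ℚ.∣p*q∣≡∣p∣*∣q∣ c (s M - a) ⟩
  ∣ c ∣ * ∣ s M - a ∣       ≤⟨ ℚ.*-monoʳ-≤-nonNeg ∣ s M - a ∣ {{ℚ.∣-∣-nonNeg (s M - a)}} ∣c∣≤b ⟩
  b * ∣ s M - a ∣           <⟨ ℚ.*-monoʳ-<-pos b (proj₂ near M N≤M) ⟩
  b * (1/ b * ε)            ≡⟨ ℚ.*-assoc b (1/ b) ε ⟨
  b * (1/ b) * ε            ≡⟨ cong (_* ε) (ℚ.*-inverseʳ b) ⟩
  1ℚ * ε                    ≡⟨ ℚ.*-identityˡ ε ⟩
  ε                         ∎
  where
  open ≤-Reasoning
  -- The added 1 keeps the bound invertible when `c` is 0.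
  b : ℚ
  b = ∣ c ∣ + 1ℚ
  instance
    b-positive : Positive b
    b-positive = positive (ℚ.+-mono-≤-< (ℚ.0≤∣p∣ c) (ℚ.positive⁻¹ 1ℚ))
    b-nonZero : NonZero b
    b-nonZero = ℚ.pos⇒nonZero b
  0<ε/b : 0ℚ < 1/ b * ε
  0<ε/b = subst (_< 1/ b * ε) (ℚ.*-zeroʳ (1/ b)) (ℚ.*-monoʳ-<-pos (1/ b) {{ℚ.1/pos⇒pos b}} 0<ε)
  near : ∃[ N ] (∀ M → N ℕ.≤ M → ∣ s M - a ∣ < 1/ b * ε)
  near = s⟶a (1/ b * ε) 0<ε/b
  ∣c∣≤b : ∣ c ∣ ≤ b
  ∣c∣≤b = subst (_≤ b) (ℚ.+-identityʳ ∣ c ∣) (ℚ.+-monoʳ-≤ ∣ c ∣ 0≤1)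
  alg : ∀ c s a → c * s - c * a ≡ c * (s - a)
  alg = solve-∀ ℚ-ring

⇝-- : ∀ {s t a b} → s ⇝ a → t ⇝ b → (λ M → s M - t M) ⇝ (a - b)
⇝-- {s} {t} {a} {b} s⟶a t⟶b =
  subst ((λ M → s M - t M) ⇝_) (sym (alg a b))
    (⇝-cong (λ M → sym (alg (s M) (t M))) (⇝-+ s⟶a (⇝-* (- 1ℚ) t⟶b)))
  where
  alg : ∀ a b → a - b ≡ a + (- 1ℚ) * b
  alg = solve-∀ ℚ-ring

⇝-sum : ∀ {s : Fin n → ℕ → ℚ} {a : Fin n → ℚ} → (∀ l → s l ⇝ a l) → (λ M → sum λ l → s l M) ⇝ sum a
⇝-sum {zero}  h = ⇝-const 0ℚ
⇝-sum {suc n} h = ⇝-+ (h zero) (⇝-sum (h ∘ suc))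

⇝-unique : ∀ {s a b} → s ⇝ a → s ⇝ b → a ≡ b
⇝-unique {s} {a} {b} s⟶a s⟶b with a - b ℚ.≟ 0ℚ
... | yes a-b≡0 = b-a≡0⇒b≡a a-b≡0
... | no  a-b≢0 with ⇝-- s⟶a s⟶b .limit ∣ a - b ∣ 0<∣a-b∣
  where
  0<∣a-b∣ : 0ℚ < ∣ a - b ∣
  0<∣a-b∣ = ℚ.≰⇒> λ ∣a-b∣≤0 → a-b≢0 (ℚ.∣p∣≡0⇒p≡0 (a - b) (ℚ.≤-antisym ∣a-b∣≤0 (ℚ.0≤∣p∣ (a - b))))
...   | N , close = contradiction (close N ℕ.≤-refl) (ℚ.<-irrefl (begin
  ∣ s N - s N - (a - b) ∣   ≡⟨ cong ∣_∣ (alg (s N) (a - b)) ⟩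
  ∣ - (a - b) ∣             ≡⟨ ℚ.∣-p∣≡∣p∣ (a - b) ⟩
  ∣ a - b ∣                 ∎))
  where
  open ≡-Reasoning
  alg : ∀ x y → x - x - y ≡ - y
  alg = solve-∀ ℚ-ring

-- The random walk

weight : Graph n → Weight n
weight G p q = 𝟙 (adj? G p q)

-- The vertices of a chain are listed in the order in which its copies are attached, whereas κ and α
-- are sums over `Fin n`; the permutation identifies the two kinds of sum.
record Enumerates (xs : List (Fin n)) : Set where
  field
    unique   : Unique xs
    complete : ∀ p → p ∈ xs

  allFin↭ : xs ↭ allFin n
  allFin↭ = ∼bag⇒↭ (unique∧set⇒bag unique (Unique.allFin⁺ n)
    (mk⇔ (λ _ → ∈-allFin _) (λ _ → complete _)))

  ∑≡sum : ∀ f → ∑ xs f ≡ sum f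
  ∑≡sum f = ≡.trans (∑-↭ allFin↭ f) (∑-tabulate id f)

allFin-enumerates : ∀ n → Enumerates (allFin n)
allFin-enumerates n = record { unique = Unique.allFin⁺ n ; complete = ∈-allFin }

module Walk {n} (G : Graph n) (connected : Connected G) {xs : List (Fin n)} (enum : Enumerates xs) where
  open Enumerates enum

  w : Weight n
  w = weight G

  -- At a maximiser other than `j` all terms of the Laplacian are nonnegative and their sum is at
  -- most 0, so every neighbour is a maximiser too. Following a path from a maximiser to `j` carries
  -- the maximum to `j`.
  maximum-principle : ∀ f j → (∀ i → i ≢ j → lap w xs f i ≤ 0ℚ) → ∀ i → f i ≤ f j
  maximum-principle f j sub = propagate max (λ i → All.lookup (f[xs]≤f[argmax] j (allFin n)) (∈-allFin i)) (connected max j)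
    where
    max = argmax f j (allFin n)
    propagate : ∀ u → (∀ i → f i ≤ f u) → Star (Adj G) u j → ∀ i → f i ≤ f j
    propagate u top stop = top
    propagate u top (_◅_ {j = l} u∼l l⋯j) i with u Fin.≟ j
    ... | yes refl = top i
    ... | no  u≢j  = propagate l (λ i → ℚ.≤-trans (top i) fu≤fl) l⋯j i
      where
      open ≤-Reasoning
      fu≤fl : f u ≤ f l
      fu≤fl = 0≤b-a⇒a≤b (begin
        0ℚ                       ≡⟨⟩
        - 0ℚ                     ≤⟨ ℚ.neg-antimono-≤ (begin
          f u - f l                 ≡⟨ ℚ.*-identityˡ (f u - f l) ⟨
          1ℚ * (f u - f l)          ≡⟨ cong (_* (f u - f l)) (𝟙-yes (adj? G u l) u∼l) ⟨
          w u l * (f u - f l)       ≤⟨ term≤∑ (λ {p} _ → *-nonNeg (0≤𝟙 (adj? G u p)) (a≤b⇒0≤b-a (top p))) (complete l) ⟩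
          lap w xs f u              ≤⟨ sub u u≢j ⟩
          0ℚ                        ∎) ⟩
        - (f u - f l)            ≡⟨ alg (f u) (f l) ⟩
        f l - f u                ∎)
        where
        alg : ∀ a b → - (a - b) ≡ b - a
        alg = solve-∀ ℚ-ring

  lap-- : ∀ (f g : Fin n → ℚ) i → lap w xs (λ l → f l - g l) i ≡ lap w xs f i - lap w xs g i
  lap-- f g i = ≡.trans
    (∑-cong {xs = xs} λ {l} _ → alg (w i l) (f i) (g i) (f l) (g l))
    (∑-- xs (λ l → w i l * (f i - f l)) (λ l → w i l * (g i - g l)))
    where
    alg : ∀ w a b c d → w * (a - b - (c - d)) ≡ w * (a - c) - w * (b - d)
    alg = solve-∀ ℚ-ring

  harmonic-unique : ∀ f g j → (∀ i → i ≢ j → lap w xs f i ≡ lap w xs g i) → f j ≡ g j → ∀ i → f i ≡ g i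
  harmonic-unique f g j same fj≡gj i = ℚ.≤-antisym (below f g same fj≡gj i) (below g f (λ i i≢j → sym (same i i≢j)) (sym fj≡gj) i)
    where
    below : ∀ f g → (∀ i → i ≢ j → lap w xs f i ≡ lap w xs g i) → f j ≡ g j → ∀ i → f i ≤ g i
    below f g same fj≡gj i = 0≤b-a⇒a≤b (begin
      0ℚ               ≡⟨⟩
      - 0ℚ             ≤⟨ ℚ.neg-antimono-≤ (begin
        f i - g i         ≤⟨ maximum-principle (λ l → f l - g l) j
                               (λ l l≢j → ℚ.≤-reflexive (≡.trans (lap-- f g l) (zero-diff (same l l≢j)))) i ⟩
        f j - g j         ≡⟨ zero-diff fj≡gj ⟩
        0ℚ                ∎) ⟩
      - (f i - g i)    ≡⟨ alg (f i) (g i) ⟩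
      g i - f i        ∎)
      where
      open ≤-Reasoning
      zero-diff : ∀ {a b} → a ≡ b → a - b ≡ 0ℚ
      zero-diff {a} refl = ℚ.+-inverseʳ a
      alg : ∀ a b → - (a - b) ≡ b - a
      alg = solve-∀ ℚ-ring

  degree≡ι : ∀ i → degree w xs i ≡ ι (deg G i)
  degree≡ι i = ≡.trans (∑≡sum (w i))
    (sym (≡.trans (ι-sum (λ l → if does (adj? G i l) then 1 else 0)) (Σ.sum-cong-≗ (λ l → ι-if (adj? G i l)))))

  degree-pos : ∀ {i l} → Adj G i l → 1ℚ ≤ degree w xs i
  degree-pos {i} {l} i∼l = subst (_≤ degree w xs i) (𝟙-yes (adj? G i l) i∼l)
    (term≤∑ (λ {p} _ → 0≤𝟙 (adj? G i p)) (complete l))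

  degree-transition : ∀ i l → degree w xs i * transition G i l ≡ w i l
  degree-transition i l with adj? G i l
  ... | no _ = ℚ.*-zeroʳ (degree w xs i)
  ... | yes i∼l = ≡.trans (cong (_* (1 ÷ deg G i)) (degree≡ι i)) (inverse (deg G i) refl)
    where
    inverse : ∀ d → deg G i ≡ d → ι d * (1 ÷ d) ≡ 1ℚ
    inverse (suc d) _ = ι-inverse d
    -- The neighbour `l` forces a degree of at least 1, so the convention `1 ÷ 0 = 0` never applies
    -- here.
    inverse zero    e = contradiction
      (subst (1ℚ ≤_) (≡.trans (degree≡ι i) (cong ι e)) (degree-pos i∼l))
      (ℚ.<-irrefl refl ∘ ℚ.<-≤-trans (ℚ.positive⁻¹ 1ℚ))

  lap-transition : ∀ f i → lap w xs f i ≡ degree w xs i * (f i - sum (λ l → transition G i l * f l))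
  lap-transition f i = begin
    lap w xs f i
      ≡⟨ ∑-cong {xs = xs} (λ {l} _ → ≡.trans (alg₁ (w i l) (f i) (f l))
           (cong (λ a → w i l * f i - a * f l) (sym (degree-transition i l)))) ⟩
    ∑[ l ∈ xs ] (w i l * f i - d * transition G i l * f l)
      ≡⟨ ∑-- xs _ _ ⟩
    ∑[ l ∈ xs ] (w i l * f i) - ∑[ l ∈ xs ] (d * transition G i l * f l)
      ≡⟨ cong₂ _-_ (∑-*ʳ xs (f i) (w i)) (≡.trans
           (∑-cong {xs = xs} λ {l} _ → ℚ.*-assoc d (transition G i l) (f l))
           (∑-* xs d _)) ⟩
    d * f i - d * ∑[ l ∈ xs ] (transition G i l * f l)
      ≡⟨ alg₂ d (f i) _ ⟩
    d * (f i - ∑[ l ∈ xs ] (transition G i l * f l))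
      ≡⟨ cong (λ s → d * (f i - s)) (∑≡sum _) ⟩
    d * (f i - sum (λ l → transition G i l * f l)) ∎
    where
    open ≡-Reasoning
    d = degree w xs i
    alg₁ : ∀ w a b → w * (a - b) ≡ w * a - w * b
    alg₁ = solve-∀ ℚ-ring
    alg₂ : ∀ d a b → d * a - d * b ≡ d * (a - b)
    alg₂ = solve-∀ ℚ-ring

  module Hitting (m : MeanFirstPassage G) where

    -- The diagonal of `time` is arbitrary. It has to be replaced by 0 for the first-step equations
    -- at the neighbours of the target to hold.
    hitting : Fin n → Fin n → ℚ
    hitting i j = if does (i Fin.≟ j) then 0ℚ else time m i j

    hitting-diag : ∀ j → hitting j j ≡ 0ℚ
    hitting-diag j with j Fin.≟ j
    ... | yes _ = refl
    ... | no ¬r = contradiction refl ¬r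

    hitting-off : ∀ {i j} → i ≢ j → hitting i j ≡ time m i j
    hitting-off {i} {j} i≢j with i Fin.≟ j
    ... | yes i≡j = contradiction i≡j i≢j
    ... | no _    = refl

    -- The partial sums F of the hitting probabilities and A of the mean times
    -- satisfy A (M+1) = P (A M + F M) and F (M+1) = P (F M) off the target, so
    -- convergence of A forces F to converge to a harmonic function equal to 1
    -- at the target, which must then be constant.
    module _ (j : Fin n) where
      private
        P : Fin n → Fin n → ℚ
        P = transition G

        φ : ℕ → Fin n → ℚ
        φ t i = firstPassage G t i j

        F A : Fin n → ℕ → ℚ
        F i M = sum {M} λ t → φ (toℕ t) i
        A i M = sum {M} λ t → ι (toℕ t) * φ (toℕ t) i

        φ-0 : ∀ {i} → i ≢ j → φ 0 i ≡ 0ℚ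
        φ-0 {i} i≢j with i Fin.≟ j
        ... | yes i≡j = contradiction i≡j i≢j
        ... | no _ = refl

        φ-suc : ∀ {i} t → i ≢ j → φ (suc t) i ≡ sum (λ l → P i l * φ t l)
        φ-suc {i} t i≢j with i Fin.≟ j
        ... | yes i≡j = contradiction i≡j i≢j
        ... | no _ = refl

        φ-0-target : φ 0 j ≡ 1ℚ
        φ-0-target with j Fin.≟ j
        ... | yes _ = refl
        ... | no ¬r = contradiction refl ¬r

        φ-suc-target : ∀ t → φ (suc t) j ≡ 0ℚ
        φ-suc-target t with j Fin.≟ j
        ... | yes _ = refl
        ... | no ¬r = contradiction refl ¬r

        sum-0 : ∀ {M} {g : Fin M → ℚ} → (∀ t → g t ≡ 0ℚ) → sum g ≡ 0ℚ
        sum-0 {M} h = ≡.trans (Σ.sum-cong-≗ h) (Σ.sum-replicate-zero M)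

        F-target : ∀ M → F j (suc M) ≡ 1ℚ
        F-target M = ≡.trans (cong₂ _+_ φ-0-target (sum-0 {M} λ t → φ-suc-target (toℕ t))) (ℚ.+-identityʳ 1ℚ)

        A-target : ∀ M → A j M ≡ 0ℚ
        A-target M = sum-0 {M} (λ t → term (toℕ t))
          where
          term : ∀ t → ι t * φ t j ≡ 0ℚ
          term zero    = ℚ.*-zeroˡ (φ 0 j)
          term (suc t) = ≡.trans (cong (ι (suc t) *_) (φ-suc-target t)) (ℚ.*-zeroʳ (ι (suc t)))

        push : ∀ {M} i (c : Fin M → ℚ) →
          sum (λ t → c t * sum (λ l → P i l * φ (toℕ t) l)) ≡ sum (λ l → P i l * sum (λ t → c t * φ (toℕ t) l))
        push {M} i c = begin
          sum (λ t → c t * sum (λ l → P i l * φ (toℕ t) l))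
            ≡⟨ Σ.sum-cong-≗ (λ t → ≡.trans (Σ.*-distribˡ-sum (c t) (λ l → P i l * φ (toℕ t) l))
                 (Σ.sum-cong-≗ λ l → alg (c t) (P i l) (φ (toℕ t) l))) ⟩
          sum (λ t → sum (λ l → P i l * (c t * φ (toℕ t) l)))
            ≡⟨ Σ.∑-comm (λ t l → P i l * (c t * φ (toℕ t) l)) ⟩
          sum (λ l → sum (λ t → P i l * (c t * φ (toℕ t) l)))
            ≡⟨ Σ.sum-cong-≗ (λ l → sym (Σ.*-distribˡ-sum (P i l) (λ t → c t * φ (toℕ t) l))) ⟩
          sum (λ l → P i l * sum (λ t → c t * φ (toℕ t) l)) ∎
          where
          open ≡-Reasoning
          alg : ∀ a b c → a * (b * c) ≡ b * (a * c)
          alg = solve-∀ ℚ-ring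

        F-suc : ∀ {i} → i ≢ j → ∀ M → F i (suc M) ≡ sum (λ l → P i l * F l M)
        F-suc {i} i≢j M = begin
          F i (suc M)
            ≡⟨ cong₂ _+_ (φ-0 i≢j) (Σ.sum-cong-≗ {M} λ t →
                 ≡.trans (φ-suc (toℕ t) i≢j) (sym (ℚ.*-identityˡ (sum (λ l → P i l * φ (toℕ t) l))))) ⟩
          0ℚ + sum {M} (λ t → 1ℚ * sum (λ l → P i l * φ (toℕ t) l))
            ≡⟨ ≡.trans (ℚ.+-identityˡ (sum {M} (λ t → 1ℚ * sum (λ l → P i l * φ (toℕ t) l)))) (push {M} i (λ _ → 1ℚ)) ⟩
          sum (λ l → P i l * sum {M} (λ t → 1ℚ * φ (toℕ t) l))
            ≡⟨ Σ.sum-cong-≗ (λ l → cong (P i l *_) (Σ.sum-cong-≗ {M} λ t → ℚ.*-identityˡ (φ (toℕ t) l))) ⟩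
          sum (λ l → P i l * F l M) ∎
          where open ≡-Reasoning

        A-suc : ∀ {i} → i ≢ j → ∀ M → A i (suc M) ≡ F i (suc M) + sum (λ l → P i l * A l M)
        A-suc {i} i≢j M = begin
          A i (suc M)
            -- The term `ι 0 * φ 0 i` is traded for `φ 0 i`, which also vanishes off the target and
            -- completes the sum to `F i (suc M)`.
            ≡⟨ cong₂ _+_ (≡.trans (ℚ.*-zeroˡ (φ 0 i)) (sym (φ-0 i≢j))) (Σ.sum-cong-≗ {M} λ t →
                 ≡.trans (cong (_* φ (suc (toℕ t)) i) (ι-+ 1 (toℕ t))) (≡.trans (alg (ι (toℕ t)) (φ (suc (toℕ t)) i))
                 (cong (λ s → φ (suc (toℕ t)) i + ι (toℕ t) * s) (φ-suc (toℕ t) i≢j)))) ⟩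
          φ 0 i + sum {M} (λ t → φ (suc (toℕ t)) i + ι (toℕ t) * sum (λ l → P i l * φ (toℕ t) l))
            ≡⟨ cong (φ 0 i +_) (Σ.∑-distrib-+ {M} (λ t → φ (suc (toℕ t)) i) (λ t → ι (toℕ t) * sum (λ l → P i l * φ (toℕ t) l))) ⟩
          φ 0 i + (sum {M} (λ t → φ (suc (toℕ t)) i) + sum {M} (λ t → ι (toℕ t) * sum (λ l → P i l * φ (toℕ t) l)))
            ≡⟨ ℚ.+-assoc (φ 0 i) _ _ ⟨
          F i (suc M) + sum {M} (λ t → ι (toℕ t) * sum (λ l → P i l * φ (toℕ t) l))
            ≡⟨ cong (F i (suc M) +_) (push {M} i (λ t → ι (toℕ t))) ⟩
          F i (suc M) + sum (λ l → P i l * A l M) ∎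
          where
          open ≡-Reasoning
          alg : ∀ a b → (1ℚ + a) * b ≡ b + a * b
          alg = solve-∀ ℚ-ring

        T : Fin n → ℚ
        T i = hitting i j

        A⟶T : ∀ i → A i ⇝ T i
        A⟶T i with i Fin.≟ j
        ... | yes refl = ⇝-cong (λ M → sym (A-target M)) (⇝-const 0ℚ)
        ... | no i≢j   = converges (time-mean m i≢j)

        -- The probability that `j` is ever reached. Its formula is `A-suc` solved for `F i (suc M)`
        -- and passed to the limit.
        h : Fin n → ℚ
        h i = if does (i Fin.≟ j) then 1ℚ else T i - sum (λ l → P i l * T l)

        h-off : ∀ {i} → i ≢ j → h i ≡ T i - sum (λ l → P i l * T l)
        h-off {i} i≢j with i Fin.≟ j
        ... | yes i≡j = contradiction i≡j i≢j
        ... | no _ = refl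

        h-target : h j ≡ 1ℚ
        h-target with j Fin.≟ j
        ... | yes _ = refl
        ... | no ¬r = contradiction refl ¬r

        F⟶h : ∀ i → F i ⇝ h i
        F⟶h i = by (i Fin.≟ j)
          where
          alg : ∀ a b → a + b - b ≡ a
          alg = solve-∀ ℚ-ring
          by : Dec (i ≡ j) → F i ⇝ h i
          -- `F j 0` is an empty sum and not 1, so the limit is taken along the shifted sequence.
          by (yes refl) = ⇝-untail {s = F i} (⇝-cong {t = λ M → F j (suc M)} (λ M → sym (F-target M)) (subst ((λ _ → 1ℚ) ⇝_) (sym h-target) (⇝-const 1ℚ)))
          by (no i≢j) = ⇝-untail {s = F i} (⇝-cong
            {s = λ M → A i (suc M) - sum (λ l → P i l * A l M)} {t = λ M → F i (suc M)}
            (λ M → ≡.trans (cong (_- sum (λ l → P i l * A l M)) (A-suc i≢j M)) (alg (F i (suc M)) (sum (λ l → P i l * A l M))))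
            (subst ((λ M → A i (suc M) - sum (λ l → P i l * A l M)) ⇝_) (sym (h-off i≢j))
              (⇝-- (⇝-tail {s = A i} (A⟶T i)) (⇝-sum (λ l → ⇝-* (P i l) (A⟶T l))))))

        h-harmonic : ∀ {i} → i ≢ j → h i ≡ sum (λ l → P i l * h l)
        h-harmonic {i} i≢j = ⇝-unique (⇝-tail {s = F i} (F⟶h i))
          (⇝-cong {t = λ M → F i (suc M)} (λ M → sym (F-suc i≢j M)) (⇝-sum (λ l → ⇝-* (P i l) (F⟶h l))))

        lap-const : ∀ c i → lap w xs (λ _ → c) i ≡ 0ℚ
        lap-const c i = ∑-zero {xs = xs} λ {l} _ → ≡.trans (cong (w i l *_) (ℚ.+-inverseʳ c)) (ℚ.*-zeroʳ (w i l))

        -- Both functions have zero Laplacian off `j` and agree at `j`. Almost sure arrival is thus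
        -- deduced from the convergence of the mean times.
        h≡1 : ∀ i → h i ≡ 1ℚ
        h≡1 = harmonic-unique h (λ _ → 1ℚ) j
          (λ i i≢j → ≡.trans (lap-transition h i) (≡.trans
            (cong (λ s → degree w xs i * (s - sum (λ l → P i l * h l))) (h-harmonic i≢j))
            (≡.trans (cong (degree w xs i *_) (ℚ.+-inverseʳ (sum (λ l → P i l * h l))))
              (≡.trans (ℚ.*-zeroʳ (degree w xs i)) (sym (lap-const 1ℚ i))))))
          h-target

      lap-hitting-off : ∀ {i} → i ≢ j → lap w xs (λ l → hitting l j) i ≡ degree w xs i
      lap-hitting-off {i} i≢j = ≡.trans (lap-transition T i) (≡.trans
        (cong (degree w xs i *_) (≡.trans (sym (h-off i≢j)) (h≡1 i))) (ℚ.*-identityʳ (degree w xs i)))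

-- Kemeny's constant

𝟙-cong : ∀ {P Q : Set} → (P → Q) → (Q → P) → (d : Dec P) (e : Dec Q) → 𝟙 d ≡ 𝟙 e
𝟙-cong to from d e = cong (λ b → if b then 1ℚ else 0ℚ) (does-⇔ (mk⇔ to from) d e)

weight-sym : ∀ (G : Graph n) p q → weight G p q ≡ weight G q p
weight-sym G p q = 𝟙-cong (adj-sym G) (adj-sym G) (adj? G p q) (adj? G q p)

-- Linearity and self-adjointness of the Laplacian

module Laplacian (w : Weight n) (xs : List (Fin n)) where
  open ≡-Reasoning

  Lap : (Fin n → ℚ) → Fin n → ℚ
  Lap = lap w xs

  lap-+ : ∀ f g i → Lap (λ l → f l + g l) i ≡ Lap f i + Lap g i
  lap-+ f g i = ≡.trans
    (∑-cong {xs = xs} λ {l} _ → alg (w i l) (f i) (g i) (f l) (g l))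
    (∑-+ xs (λ l → w i l * (f i - f l)) (λ l → w i l * (g i - g l)))
    where
    alg : ∀ w a b c d → w * (a + b - (c + d)) ≡ w * (a - c) + w * (b - d)
    alg = solve-∀ ℚ-ring

  lap-* : ∀ c f i → Lap (λ l → c * f l) i ≡ c * Lap f i
  lap-* c f i = ≡.trans
    (∑-cong {xs = xs} λ {l} _ → alg c (w i l) (f i) (f l))
    (∑-* xs c (λ l → w i l * (f i - f l)))
    where
    alg : ∀ c w a b → w * (c * a - c * b) ≡ c * (w * (a - b))
    alg = solve-∀ ℚ-ring

  lap-shift : ∀ f c i → Lap (λ l → f l + c) i ≡ Lap f i
  lap-shift f c i = ∑-cong {xs = xs} λ {l} _ → alg (w i l) (f i) (f l) c
    where
    alg : ∀ w a b c → w * (a + c - (b + c)) ≡ w * (a - b)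
    alg = solve-∀ ℚ-ring

  lap-∑ : ∀ (a : Fin n → ℚ) (f : Fin n → Fin n → ℚ) i →
    Lap (λ l → ∑[ p ∈ xs ] (a p * f p l)) i ≡ ∑[ p ∈ xs ] (a p * Lap (f p) i)
  lap-∑ a f i = begin
    ∑[ l ∈ xs ] (w i l * (∑[ p ∈ xs ] (a p * f p i) - ∑[ p ∈ xs ] (a p * f p l)))
      ≡⟨ ∑-cong {xs = xs} (λ {l} _ → begin
           w i l * (∑[ p ∈ xs ] (a p * f p i) - ∑[ p ∈ xs ] (a p * f p l))
             ≡⟨ cong (w i l *_) (∑-- xs (λ p → a p * f p i) (λ p → a p * f p l)) ⟨
           w i l * ∑[ p ∈ xs ] (a p * f p i - a p * f p l)
             ≡⟨ ∑-* xs (w i l) (λ p → a p * f p i - a p * f p l) ⟨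
           ∑[ p ∈ xs ] (w i l * (a p * f p i - a p * f p l))
             ≡⟨ ∑-cong {xs = xs} (λ {p} _ → alg (w i l) (a p) (f p i) (f p l)) ⟩
           ∑[ p ∈ xs ] (a p * (w i l * (f p i - f p l))) ∎) ⟩
    ∑[ l ∈ xs ] ∑[ p ∈ xs ] (a p * (w i l * (f p i - f p l)))
      ≡⟨ ∑-comm xs xs (λ l p → a p * (w i l * (f p i - f p l))) ⟩
    ∑[ p ∈ xs ] ∑[ l ∈ xs ] (a p * (w i l * (f p i - f p l)))
      ≡⟨ ∑-cong {xs = xs} (λ {p} _ → ∑-* xs (a p) (λ l → w i l * (f p i - f p l))) ⟩
    ∑[ p ∈ xs ] (a p * Lap (f p) i) ∎
    where
    alg : ∀ w a b c → w * (a * b - a * c) ≡ a * (w * (b - c))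
    alg = solve-∀ ℚ-ring

  module _ (w-sym : ∀ p q → w p q ≡ w q p) where

    private
      B : (Fin n → ℚ) → (Fin n → ℚ) → ℚ
      B f g = ∑[ i ∈ xs ] ∑[ l ∈ xs ] (w i l * (f i * g l))

      B-sym : ∀ f g → B f g ≡ B g f
      B-sym f g = ≡.trans (∑-comm xs xs (λ i l → w i l * (f i * g l)))
        (∑-cong {xs = xs} λ {l} _ → ∑-cong {xs = xs} λ {i} _ → cong₂ _*_ (w-sym i l) (ℚ.*-comm (f i) (g l)))

      expand : ∀ f g → ∑[ i ∈ xs ] (f i * Lap g i) ≡ ∑[ i ∈ xs ] (degree w xs i * (f i * g i)) - B f g
      expand f g = begin
        ∑[ i ∈ xs ] (f i * Lap g i)
          ≡⟨ ∑-cong {xs = xs} (λ {i} _ → begin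
               f i * Lap g i
                 ≡⟨ ∑-* xs (f i) (λ l → w i l * (g i - g l)) ⟨
               ∑[ l ∈ xs ] (f i * (w i l * (g i - g l)))
                 ≡⟨ ∑-cong {xs = xs} (λ {l} _ → alg (f i) (w i l) (g i) (g l)) ⟩
               ∑[ l ∈ xs ] (w i l * (f i * g i) - w i l * (f i * g l))
                 ≡⟨ ∑-- xs (λ l → w i l * (f i * g i)) (λ l → w i l * (f i * g l)) ⟩
               ∑[ l ∈ xs ] (w i l * (f i * g i)) - ∑[ l ∈ xs ] (w i l * (f i * g l))
                 ≡⟨ cong (_- ∑[ l ∈ xs ] (w i l * (f i * g l))) (∑-*ʳ xs (f i * g i) (w i)) ⟩
               degree w xs i * (f i * g i) - ∑[ l ∈ xs ] (w i l * (f i * g l)) ∎) ⟩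
        ∑[ i ∈ xs ] (degree w xs i * (f i * g i) - ∑[ l ∈ xs ] (w i l * (f i * g l)))
          ≡⟨ ∑-- xs (λ i → degree w xs i * (f i * g i)) (λ i → ∑[ l ∈ xs ] (w i l * (f i * g l))) ⟩
        ∑[ i ∈ xs ] (degree w xs i * (f i * g i)) - B f g ∎
        where
        alg : ∀ a w b c → a * (w * (b - c)) ≡ w * (a * b) - w * (a * c)
        alg = solve-∀ ℚ-ring

    self-adjoint : ∀ f g → ∑[ i ∈ xs ] (f i * Lap g i) ≡ ∑[ i ∈ xs ] (g i * Lap f i)
    self-adjoint f g = begin
      ∑[ i ∈ xs ] (f i * Lap g i)
        ≡⟨ expand f g ⟩
      ∑[ i ∈ xs ] (degree w xs i * (f i * g i)) - B f g
        ≡⟨ cong₂ _-_ (∑-cong {xs = xs} λ {i} _ → cong (degree w xs i *_) (ℚ.*-comm (f i) (g i))) (B-sym f g) ⟩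
      ∑[ i ∈ xs ] (degree w xs i * (g i * f i)) - B g f
        ≡⟨ expand g f ⟨
      ∑[ i ∈ xs ] (g i * Lap f i) ∎

    ∑-lap : ∀ f → ∑ xs (Lap f) ≡ 0ℚ
    ∑-lap f = begin
      ∑ xs (Lap f)                          ≡⟨ ∑-cong {xs = xs} (λ {i} _ → ℚ.*-identityˡ (Lap f i)) ⟨
      ∑[ i ∈ xs ] (1ℚ * Lap f i)            ≡⟨ self-adjoint (λ _ → 1ℚ) f ⟩
      ∑[ i ∈ xs ] (f i * Lap (λ _ → 1ℚ) i)  ≡⟨ ∑-zero {xs = xs} (λ {i} _ → ≡.trans (cong (f i *_) (∑-zero {xs = xs} λ {l} _ → ℚ.*-zeroʳ (w i l))) (ℚ.*-zeroʳ (f i))) ⟩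
      0ℚ                                    ∎

module Kemeny {n} (G : Graph n) (connected : Connected G) {xs : List (Fin n)} (enum : Enumerates xs)
  (m : MeanFirstPassage G) where
  open Enumerates enum
  open Walk G connected enum public
  open Hitting m public
  open Laplacian w xs
  open ≡-Reasoning

  d : Fin n → ℚ
  d = degree w xs

  V : ℚ
  V = volume w xs

  -- By the convention for `÷` this is 0 when there are no edges; it inverts `V` only when there is
  -- an edge.
  V⁻¹ : ℚ
  V⁻¹ = 1 ÷ (2 ℕ.* edges G)

  handshake : ι (2 ℕ.* edges G) ≡ V
  handshake = begin
    ι (2 ℕ.* edges G)
      ≡⟨ ≡.trans (cong ι (cong (edges G ℕ.+_) (ℕ.+-identityʳ (edges G)))) (ι-+ (edges G) (edges G)) ⟩
    ι (edges G) + ι (edges G)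
      ≡⟨ cong₂ _+_ edges≡ (≡.trans edges≡ (∑-comm xs xs up)) ⟩
    ∑[ u ∈ xs ] ∑[ v ∈ xs ] up u v + ∑[ u ∈ xs ] ∑[ v ∈ xs ] up v u
      ≡⟨ ∑-+ xs (λ u → ∑[ v ∈ xs ] up u v) (λ u → ∑[ v ∈ xs ] up v u) ⟨
    ∑[ u ∈ xs ] (∑[ v ∈ xs ] up u v + ∑[ v ∈ xs ] up v u)
      ≡⟨ ∑-cong {xs = xs} (λ {u} _ → ≡.trans (sym (∑-+ xs (up u) (λ v → up v u))) (∑-cong {xs = xs} λ {v} _ → split u v)) ⟩
    V ∎
    where
    up : Fin n → Fin n → ℚ
    up u v = 𝟙 ((u Fin.<? v) ×-dec adj? G u v)

    edges≡ : ι (edges G) ≡ ∑[ u ∈ xs ] ∑[ v ∈ xs ] up u v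
    edges≡ = begin
      ι (edges G)
        ≡⟨ ι-sum (λ u → sumℕ λ v → if does ((u Fin.<? v) ×-dec adj? G u v) then 1 else 0) ⟩
      sum (λ u → ι (sumℕ λ v → if does ((u Fin.<? v) ×-dec adj? G u v) then 1 else 0))
        ≡⟨ Σ.sum-cong-≗ (λ u → ≡.trans (ι-sum (λ v → if does ((u Fin.<? v) ×-dec adj? G u v) then 1 else 0))
             (≡.trans (Σ.sum-cong-≗ (λ v → ι-if ((u Fin.<? v) ×-dec adj? G u v))) (sym (∑≡sum (up u))))) ⟩
      sum (λ u → ∑[ v ∈ xs ] up u v)
        ≡⟨ ∑≡sum (λ u → ∑[ v ∈ xs ] up u v) ⟨
      ∑[ u ∈ xs ] ∑[ v ∈ xs ] up u v ∎

    split : ∀ u v → up u v + up v u ≡ w u v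
    split u v with Fin.<-cmp u v
    ... | tri< u<v _ v≮u = ≡.trans (cong₂ _+_
        (𝟙-cong proj₂ (u<v ,_) ((u Fin.<? v) ×-dec adj? G u v) (adj? G u v))
        (𝟙-no ((v Fin.<? u) ×-dec adj? G v u) (v≮u ∘ proj₁)))
      (ℚ.+-identityʳ (w u v))
    ... | tri> u≮v _ v<u = ≡.trans (cong₂ _+_
        (𝟙-no ((u Fin.<? v) ×-dec adj? G u v) (u≮v ∘ proj₁))
        (𝟙-cong (adj-sym G ∘ proj₂) ((v<u ,_) ∘ adj-sym G) ((v Fin.<? u) ×-dec adj? G v u) (adj? G u v)))
      (ℚ.+-identityˡ (w u v))
    ... | tri≈ u≮v u≡v v≮u = ≡.trans (cong₂ _+_
        (𝟙-no ((u Fin.<? v) ×-dec adj? G u v) (u≮v ∘ proj₁))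
        (𝟙-no ((v Fin.<? u) ×-dec adj? G v u) (v≮u ∘ proj₁)))
      (sym (𝟙-no (adj? G u v) (adj-irrefl G u≡v)))

  stationary≡ : ∀ j → stationary G j ≡ V⁻¹ * d j
  stationary≡ j = begin
    stationary G j        ≡⟨ ÷-ι (deg G j) (2 ℕ.* edges G) ⟩
    ι (deg G j) * V⁻¹     ≡⟨ cong (_* V⁻¹) (degree≡ι j) ⟨
    d j * V⁻¹             ≡⟨ ℚ.*-comm (d j) V⁻¹ ⟩
    V⁻¹ * d j             ∎

  sumExcept≡ : ∀ i (f g : Fin n → ℚ) → g i ≡ 0ℚ → (∀ {j} → j ≢ i → f j ≡ g j) →
    sumExcept i (λ j → stationary G j * f j) ≡ V⁻¹ * ∑[ j ∈ xs ] (d j * g j)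
  sumExcept≡ i f g gi≡0 f≡g = begin
    sum term                                  ≡⟨ ∑≡sum term ⟨
    ∑ xs term                                 ≡⟨ ∑-cong {xs = xs} (λ {j} _ → by j) ⟩
    ∑[ j ∈ xs ] (V⁻¹ * (d j * g j))           ≡⟨ ∑-* xs V⁻¹ (λ j → d j * g j) ⟩
    V⁻¹ * ∑[ j ∈ xs ] (d j * g j)             ∎
    where
    term : Fin n → ℚ
    term j = if does (j Fin.≟ i) then 0ℚ else stationary G j * f j
    by : ∀ j → term j ≡ V⁻¹ * (d j * g j)
    by j with j Fin.≟ i
    ... | yes refl = sym (≡.trans (cong (λ a → V⁻¹ * (d j * a)) gi≡0)
                       (≡.trans (cong (V⁻¹ *_) (ℚ.*-zeroʳ (d j))) (ℚ.*-zeroʳ V⁻¹)))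
    ... | no j≢i = ≡.trans (cong₂ _*_ (stationary≡ j) (f≡g j≢i)) (ℚ.*-assoc V⁻¹ (d j) (g j))

  kemeny≡ : ∀ i → kemeny G m i ≡ V⁻¹ * ∑[ j ∈ xs ] (d j * hitting i j)
  kemeny≡ i = sumExcept≡ i (time m i) (hitting i) (hitting-diag i) (λ j≢i → sym (hitting-off (j≢i ∘ sym)))

  total : Fin n → ℚ
  total v = ∑[ i ∈ xs ] (d i * hitting i v)

  accessibility≡ : ∀ v → accessibility G m v ≡ V⁻¹ * total v
  accessibility≡ v = sumExcept≡ v (λ i → time m i v) (λ i → hitting i v) (hitting-diag v) (λ i≢v → sym (hitting-off i≢v))

  -- The first-step equation is silent at the target. There the value is forced because a Laplacian
  -- sums to 0: the deviations from `d` add up to `- V`, and all but the one at `j` vanish.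
  lap-hitting : ∀ j i → Lap (λ l → hitting l j) i ≡ d i - V * δ i j
  lap-hitting j i = solution (i Fin.≟ j)
    where
    L : Fin n → ℚ
    L = Lap (λ l → hitting l j)
    excess-off : ∀ {i} → i ≢ j → L i - d i ≡ 0ℚ
    excess-off {i} i≢j = ≡.trans (cong (_- d i) (lap-hitting-off j i≢j)) (ℚ.+-inverseʳ (d i))
    excess-target : L j - d j ≡ 0ℚ - V
    excess-target = begin
      L j - d j
        ≡⟨ ∑-δ unique (complete j) (λ i → L i - d i) ⟨
      ∑[ i ∈ xs ] (δ i j * (L i - d i))
        ≡⟨ ∑-cong {xs = xs} (λ {i} _ → only i (i Fin.≟ j)) ⟩
      ∑[ i ∈ xs ] (L i - d i)
        ≡⟨ ∑-- xs L d ⟩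
      ∑ xs L - V
        ≡⟨ cong (_- V) (∑-lap (weight-sym G) (λ l → hitting l j)) ⟩
      0ℚ - V ∎
      where
      only : ∀ i → Dec (i ≡ j) → δ i j * (L i - d i) ≡ L i - d i
      only i (yes refl) = ≡.trans (cong (_* (L i - d i)) (δ-diag i)) (ℚ.*-identityˡ (L i - d i))
      only i (no i≢j) = ≡.trans (cong (_* (L i - d i)) (δ-off i≢j))
        (≡.trans (ℚ.*-zeroˡ (L i - d i)) (sym (excess-off i≢j)))
    solution : Dec (i ≡ j) → L i ≡ d i - V * δ i j
    solution (yes refl) = begin
      L i                  ≡⟨ b-a+a≡b (d i) (L i) ⟨
      L i - d i + d i      ≡⟨ cong (_+ d i) excess-target ⟩
      0ℚ - V + d i         ≡⟨ alg V (d i) ⟩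
      d i - V * 1ℚ         ≡⟨ cong (λ a → d i - V * a) (δ-diag i) ⟨
      d i - V * δ i i      ∎
      where
      alg : ∀ v d → 0ℚ - v + d ≡ d - v * 1ℚ
      alg = solve-∀ ℚ-ring
    solution (no i≢j) = begin
      L i                  ≡⟨ lap-hitting-off j i≢j ⟩
      d i                  ≡⟨ alg V (d i) ⟩
      d i - V * 0ℚ         ≡⟨ cong (λ a → d i - V * a) (δ-off i≢j) ⟨
      d i - V * δ i j      ∎
      where
      alg : ∀ v d → d ≡ d - v * 0ℚ
      alg = solve-∀ ℚ-ring

  0≤d : ∀ i → 0ℚ ≤ d i
  0≤d i = ∑-nonNeg {xs = xs} λ {l} _ → 0≤𝟙 (adj? G i l)

  0≤V : 0ℚ ≤ V
  0≤V = ∑-nonNeg {xs = xs} λ {i} _ → 0≤d i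

  -- The negated hitting time has Laplacian `- d` off the target, so by the maximum principle it is
  -- largest at the target, where it is 0.
  0≤hitting : ∀ i j → 0ℚ ≤ hitting i j
  0≤hitting i j = 0≤b-a⇒a≤b (subst (0ℚ ≤_) (alg (hitting i j)) (ℚ.neg-antimono-≤ -h≤0))
    where
    alg : ∀ a → - ((- 1ℚ) * a) ≡ a - 0ℚ
    alg = solve-∀ ℚ-ring
    -h≤0 : (- 1ℚ) * hitting i j ≤ 0ℚ
    -h≤0 = subst ((- 1ℚ) * hitting i j ≤_) (≡.trans (cong ((- 1ℚ) *_) (hitting-diag j)) (ℚ.*-zeroʳ (- 1ℚ)))
      (maximum-principle (λ l → (- 1ℚ) * hitting l j) j
        (λ k k≢j → subst (_≤ 0ℚ)
          (sym (≡.trans (lap-* (- 1ℚ) (λ l → hitting l j) k) (≡.trans (cong ((- 1ℚ) *_) (lap-hitting-off j k≢j)) (minus (d k)))))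
          (ℚ.neg-antimono-≤ (0≤d k))) i)
      where
      minus : ∀ a → (- 1ℚ) * a ≡ - a
      minus = solve-∀ ℚ-ring

  ∑-d-lap : ∀ (f : Fin n → ℚ) j → ∑[ i ∈ xs ] (f i * (d i - V * δ i j)) ≡ ∑[ i ∈ xs ] (d i * f i) - V * f j
  ∑-d-lap f j = begin
    ∑[ i ∈ xs ] (f i * (d i - V * δ i j))
      ≡⟨ ∑-cong {xs = xs} (λ {i} _ → alg (f i) (d i) V (δ i j)) ⟩
    ∑[ i ∈ xs ] (d i * f i - V * (δ i j * f i))
      ≡⟨ ∑-- xs (λ i → d i * f i) (λ i → V * (δ i j * f i)) ⟩
    ∑[ i ∈ xs ] (d i * f i) - ∑[ i ∈ xs ] (V * (δ i j * f i))
      ≡⟨ cong (λ s → ∑[ i ∈ xs ] (d i * f i) - s) (≡.trans (∑-* xs V (λ i → δ i j * f i)) (cong (V *_) (∑-δ unique (complete j) f))) ⟩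
    ∑[ i ∈ xs ] (d i * f i) - V * f j ∎
    where
    alg : ∀ f d v e → f * (d - v * e) ≡ d * f - v * (e * f)
    alg = solve-∀ ℚ-ring

  -- Green's identity for the two functions `hitting · a` and `hitting · b`. It expresses the
  -- asymmetry of passage times through accessibility.
  reciprocity : ∀ a b → total a - V * hitting b a ≡ total b - V * hitting a b
  reciprocity a b = begin
    total a - V * hitting b a                            ≡⟨ ∑-d-lap (λ i → hitting i a) b ⟨
    ∑[ i ∈ xs ] (hitting i a * (d i - V * δ i b))        ≡⟨ ∑-cong {xs = xs} (λ {i} _ → cong (hitting i a *_) (lap-hitting b i)) ⟨
    ∑[ i ∈ xs ] (hitting i a * Lap (λ l → hitting l b) i) ≡⟨ self-adjoint (weight-sym G) (λ i → hitting i a) (λ i → hitting i b) ⟩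
    ∑[ i ∈ xs ] (hitting i b * Lap (λ l → hitting l a) i) ≡⟨ ∑-cong {xs = xs} (λ {i} _ → cong (hitting i b *_) (lap-hitting a i)) ⟩
    ∑[ i ∈ xs ] (hitting i b * (d i - V * δ i a))        ≡⟨ ∑-d-lap (λ i → hitting i b) a ⟩
    total b - V * hitting a b                            ∎

  -- Passage times and Kemeny's constant from resistances

  module _ {R : Weight n} (res : IsResistance w xs R) where
    open IsResistance res
    private
      e = eccentricity w xs R

      lap-e : ∀ i → Lap e i ≡ V * current i - 2* d i
      lap-e i = begin
        Lap e i
          ≡⟨ lap-∑ d R i ⟩
        ∑[ p ∈ xs ] (d p * Lap (R p) i)
          ≡⟨ ∑-cong {xs = xs} (λ {p} _ → begin
               d p * Lap (R p) i
                 ≡⟨ cong (d p *_) (∑-cong {xs = xs} λ {l} _ → cong (w i l *_) (cong₂ _-_ (symmetric p i) (symmetric p l))) ⟩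
               d p * Lap (λ l → R l p) i
                 ≡⟨ cong (d p *_) (≡.trans (kirchhoff (complete i) (complete p)) (cong (λ a → current i - 2* a) (δ-sym i p))) ⟩
               d p * (current i - 2* δ p i)
                 ≡⟨ alg (d p) (current i) (δ p i) ⟩
               d p * current i - (δ p i * (2* d p)) ∎) ⟩
        ∑[ p ∈ xs ] (d p * current i - (δ p i * (2* d p)))
          ≡⟨ ∑-- xs (λ p → d p * current i) (λ p → δ p i * (2* d p)) ⟩
        ∑[ p ∈ xs ] (d p * current i) - ∑[ p ∈ xs ] (δ p i * (2* d p))
          ≡⟨ cong₂ _-_ (∑-*ʳ xs (current i) d) (∑-δ unique (complete i) (λ p → 2* d p)) ⟩
        V * current i - 2* d i ∎
        where
        alg : ∀ d c e → d * (c - (e + e)) ≡ d * c - e * (d + d)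
        alg = solve-∀ ℚ-ring

      -- Tetali's formula. The Laplacians agree at every vertex, the unknown `current` cancelling
      -- between `R` and `e`, and both sides vanish at `j`.
      hitting≡ : ∀ j i → 2* hitting i j ≡ V * R i j + (- 1ℚ) * e i + e j
      hitting≡ j = harmonic-unique (λ i → 2* hitting i j) (λ i → V * R i j + (- 1ℚ) * e i + e j) j
        (λ i _ → begin
          Lap (λ l → 2* hitting l j) i
            ≡⟨ ≡.trans (lap-+ (λ l → hitting l j) (λ l → hitting l j) i) (cong 2*_ (lap-hitting j i)) ⟩
          2* (d i - V * δ i j)
            ≡⟨ alg (d i) V (δ i j) (current i) ⟩
          V * (current i - 2* δ i j) + (- 1ℚ) * (V * current i - 2* d i)
            ≡⟨ cong₂ (λ a b → V * a + (- 1ℚ) * b) (kirchhoff (complete i) (complete j)) (lap-e i) ⟨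
          V * Lap (λ l → R l j) i + (- 1ℚ) * Lap e i
            ≡⟨ cong₂ _+_ (lap-* V (λ l → R l j) i) (lap-* (- 1ℚ) e i) ⟨
          Lap (λ l → V * R l j) i + Lap (λ l → (- 1ℚ) * e l) i
            ≡⟨ lap-+ (λ l → V * R l j) (λ l → (- 1ℚ) * e l) i ⟨
          Lap (λ l → V * R l j + (- 1ℚ) * e l) i
            ≡⟨ lap-shift (λ l → V * R l j + (- 1ℚ) * e l) (e j) i ⟨
          Lap (λ l → V * R l j + (- 1ℚ) * e l + e j) i ∎)
        (begin
          2* hitting j j                        ≡⟨ cong 2*_ (hitting-diag j) ⟩
          0ℚ                                    ≡⟨ alg′ V (e j) ⟩
          V * 0ℚ + (- 1ℚ) * e j + e j           ≡⟨ cong (λ a → V * a + (- 1ℚ) * e j + e j) (diagonal j) ⟨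
          V * R j j + (- 1ℚ) * e j + e j        ∎)
        where
        alg : ∀ d v e c → (d - v * e) + (d - v * e) ≡ v * (c - (e + e)) + (- 1ℚ) * (v * c - (d + d))
        alg = solve-∀ ℚ-ring
        alg′ : ∀ v e → 0ℚ ≡ v * 0ℚ + (- 1ℚ) * e + e
        alg′ = solve-∀ ℚ-ring

    -- When `hitting≡` is averaged over the target with weights `d`, the contributions `V * e i` of
    -- the starting vertex cancel. Independence of the starting vertex comes out at the same time.
    kemeny-energy : ∀ i → 2* kemeny G m i ≡ V⁻¹ * energy w xs R
    kemeny-energy i = begin
      2* kemeny G m i
        ≡⟨ cong 2*_ (kemeny≡ i) ⟩
      2* (V⁻¹ * S)
        ≡⟨ ≡.trans (alg₁ V⁻¹ S) (cong (V⁻¹ *_) (begin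
             S + S
               ≡⟨ ∑-+ xs (λ j → d j * hitting i j) (λ j → d j * hitting i j) ⟨
             ∑[ j ∈ xs ] (2* (d j * hitting i j))
               ≡⟨ ∑-cong {xs = xs} (λ {j} _ → begin
                    2* (d j * hitting i j)
                      ≡⟨ ≡.trans (alg₁ (d j) (hitting i j)) (cong (d j *_) (hitting≡ j i)) ⟩
                    d j * (V * R i j + (- 1ℚ) * e i + e j)
                      ≡⟨ cong (λ r → d j * (V * r + (- 1ℚ) * e i + e j)) (symmetric i j) ⟩
                    d j * (V * R j i + (- 1ℚ) * e i + e j)
                      ≡⟨ alg₃ (d j) V (R j i) (e i) (e j) ⟩
                    V * (d j * R j i) + (d j * ((- 1ℚ) * e i) + d j * e j) ∎) ⟩
             ∑[ j ∈ xs ] (V * (d j * R j i) + (d j * ((- 1ℚ) * e i) + d j * e j))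
               ≡⟨ ≡.trans (∑-+ xs (λ j → V * (d j * R j i)) (λ j → d j * ((- 1ℚ) * e i) + d j * e j))
                    (cong (∑[ j ∈ xs ] (V * (d j * R j i)) +_) (∑-+ xs (λ j → d j * ((- 1ℚ) * e i)) (λ j → d j * e j))) ⟩
             ∑[ j ∈ xs ] (V * (d j * R j i)) + (∑[ j ∈ xs ] (d j * ((- 1ℚ) * e i)) + energy w xs R)
               ≡⟨ cong₂ (λ a b → a + (b + energy w xs R)) (∑-* xs V (λ j → d j * R j i)) (∑-*ʳ xs ((- 1ℚ) * e i) d) ⟩
             V * e i + (V * ((- 1ℚ) * e i) + energy w xs R)
               ≡⟨ alg₄ V (e i) (energy w xs R) ⟩
             energy w xs R ∎)) ⟩
      V⁻¹ * energy w xs R ∎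
      where
      S : ℚ
      S = ∑[ j ∈ xs ] (d j * hitting i j)
      alg₁ : ∀ a b → a * b + a * b ≡ a * (b + b)
      alg₁ = solve-∀ ℚ-ring
      alg₃ : ∀ d v r e f → d * (v * r + (- 1ℚ) * e + f) ≡ v * (d * r) + (d * ((- 1ℚ) * e) + d * f)
      alg₃ = solve-∀ ℚ-ring
      alg₄ : ∀ v e w → v * e + (v * ((- 1ℚ) * e) + w) ≡ w
      alg₄ = solve-∀ ℚ-ring

  -- Effective resistance as commute time divided by the volume.
  private
    resistance′ : ∀ e → 2 ℕ.* edges G ≡ e → ∃[ R ] (IsResistance w xs R ×
      (∀ {u v} → accessibility G m u ≤ accessibility G m v → eccentricity w xs R u ≤ eccentricity w xs R v))
    -- Without edges a connected graph has at most one vertex. Then `R` is 0, and the current 2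
    -- balances the 2 extracted at the same vertex.
    resistance′ zero m≡0 = (λ _ _ → 0ℚ) , record
      { current = λ _ → 2* 1ℚ ; symmetric = λ _ _ → refl ; diagonal = λ _ → refl ; 0≤R = λ _ _ → ℚ.≤-refl
      ; kirchhoff = λ {p} {q} _ _ → ≡.trans (∑-zero {xs = xs} λ {l} _ → ℚ.*-zeroʳ (w p l))
          (sym (cong (λ a → 2* 1ℚ - 2* a) (≡.trans (cong (λ r → δ r q) (single p q)) (δ-diag q)))) }
      , λ {u} {v} _ → ℚ.≤-reflexive (≡.trans (zeros u) (sym (zeros v)))
      where
      zeros : ∀ u → eccentricity w xs (λ _ _ → 0ℚ) u ≡ 0ℚ
      zeros u = ∑-zero {xs = xs} λ {p} _ → ℚ.*-zeroʳ (d p)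
      V≡0 : V ≡ 0ℚ
      V≡0 = ≡.trans (sym handshake) (cong ι m≡0)
      single : ∀ p q → p ≡ q
      single p q with connected p q
      ... | stop = refl
      ... | p∼l ◅ _ = contradiction (ℚ.<-≤-trans (ℚ.positive⁻¹ 1ℚ)
              (ℚ.≤-trans (degree-pos p∼l) (subst (d p ≤_) V≡0 (term≤∑ (λ {i} _ → 0≤d i) (complete p)))))
              (ℚ.<-irrefl refl)
    resistance′ (suc e) m≡ = R , record
      -- The part free of `q` in the Laplacian of `R≡`, taken in the first argument.
      { current = λ p → V⁻¹ * (2* d p + V⁻¹ * Lap total p)
      ; symmetric = λ p q → cong (V⁻¹ *_) (ℚ.+-comm (hitting p q) (hitting q p))
      ; diagonal = λ p → ≡.trans (cong (λ a → V⁻¹ * (2* a)) (hitting-diag p)) (ℚ.*-zeroʳ V⁻¹)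
      ; 0≤R = λ p q → *-nonNeg (0≤÷ 1 (2 ℕ.* edges G)) (+-nonNeg (0≤hitting p q) (0≤hitting q p))
      ; kirchhoff = λ {p} {q} _ _ → kirch p q }
      , λ {u} {v} αu≤αv → subst₂ _≤_ (sym (ecc u)) (sym (ecc v)) (ℚ.+-monoˡ-≤ C αu≤αv)
      where
      V*V⁻¹ : V * V⁻¹ ≡ 1ℚ
      V*V⁻¹ = ≡.trans (cong (_* V⁻¹) (sym handshake)) (≡.trans (cong (λ b → ι b * (1 ÷ b)) m≡) (ι-inverse e))

      α : Fin n → ℚ
      α u = V⁻¹ * total u

      R : Weight n
      R p q = V⁻¹ * (hitting p q + hitting q p)

      -- In `hitting q p` the vertex `p` is the target, a position in which no Laplace equation is
      -- known. `reciprocity` trades that term for `hitting p q` and accessibilities.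
      R≡ : ∀ p q → R p q ≡ V⁻¹ * (2* hitting p q + α p + - α q)
      R≡ p q = cong (V⁻¹ *_) (begin
        hitting p q + hitting q p
          ≡⟨ alg₁ (hitting p q) (hitting q p) ⟩
        hitting p q + 1ℚ * hitting q p
          ≡⟨ cong (λ a → hitting p q + a * hitting q p) V*V⁻¹ ⟨
        hitting p q + V * V⁻¹ * hitting q p
          ≡⟨ alg₂ (hitting p q) V V⁻¹ (hitting q p) (total p) ⟩
        hitting p q + α p - V⁻¹ * (total p - V * hitting q p)
          ≡⟨ cong (λ a → hitting p q + α p - V⁻¹ * a) (reciprocity p q) ⟩
        hitting p q + α p - V⁻¹ * (total q - V * hitting p q)
          ≡⟨ alg₃ (hitting p q) (α p) V⁻¹ (total q) V ⟩
        hitting p q + V * V⁻¹ * hitting p q + α p + - α q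
          ≡⟨ cong (λ a → hitting p q + a * hitting p q + α p + - α q) V*V⁻¹ ⟩
        hitting p q + 1ℚ * hitting p q + α p + - α q
          ≡⟨ cong (λ a → hitting p q + a + α p + - α q) (ℚ.*-identityˡ (hitting p q)) ⟩
        2* hitting p q + α p + - α q ∎)
        where
        alg₁ : ∀ a b → a + b ≡ a + 1ℚ * b
        alg₁ = solve-∀ ℚ-ring
        alg₂ : ∀ a v u b t → a + v * u * b ≡ a + u * t - u * (t - v * b)
        alg₂ = solve-∀ ℚ-ring
        alg₃ : ∀ a b u t v → a + b - u * (t - v * a) ≡ a + v * u * a + b + - (u * t)
        alg₃ = solve-∀ ℚ-ring

      kirch : ∀ p q → Lap (λ l → R l q) p ≡ V⁻¹ * (2* d p + V⁻¹ * Lap total p) - 2* δ p q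
      kirch p q = begin
        Lap (λ l → R l q) p
          ≡⟨ ∑-cong {xs = xs} (λ {l} _ → cong (w p l *_) (cong₂ _-_ (R≡ p q) (R≡ l q))) ⟩
        Lap (λ l → V⁻¹ * (2* hitting l q + α l + - α q)) p
          ≡⟨ lap-* V⁻¹ (λ l → 2* hitting l q + α l + - α q) p ⟩
        V⁻¹ * Lap (λ l → 2* hitting l q + α l + - α q) p
          ≡⟨ cong (V⁻¹ *_) (begin
               Lap (λ l → 2* hitting l q + α l + - α q) p
                 ≡⟨ lap-shift (λ l → 2* hitting l q + α l) (- α q) p ⟩
               Lap (λ l → 2* hitting l q + α l) p
                 ≡⟨ lap-+ (λ l → 2* hitting l q) α p ⟩
               Lap (λ l → 2* hitting l q) p + Lap α p
                 ≡⟨ cong₂ _+_ (≡.trans (lap-+ (λ l → hitting l q) (λ l → hitting l q) p) (cong 2*_ (lap-hitting q p))) (lap-* V⁻¹ total p) ⟩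
               2* (d p - V * δ p q) + V⁻¹ * Lap total p ∎) ⟩
        V⁻¹ * (2* (d p - V * δ p q) + V⁻¹ * Lap total p)
          ≡⟨ alg V⁻¹ (d p) V (δ p q) (V⁻¹ * Lap total p) ⟩
        V⁻¹ * (2* d p + V⁻¹ * Lap total p) - V * V⁻¹ * (2* δ p q)
          ≡⟨ cong (λ s → V⁻¹ * (2* d p + V⁻¹ * Lap total p) - s) (≡.trans (cong (_* (2* δ p q)) V*V⁻¹) (ℚ.*-identityˡ (2* δ p q))) ⟩
        V⁻¹ * (2* d p + V⁻¹ * Lap total p) - 2* δ p q ∎
        where
        alg : ∀ u d v e t → u * ((d - v * e) + (d - v * e) + t) ≡ u * (d + d + t) - v * u * (e + e)
        alg = solve-∀ ℚ-ring

      C : ℚ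
      C = V⁻¹ * ∑[ p ∈ xs ] (d p * α p)

      -- In the sum of `R≡` the passage times contribute `2* α q` and the term `- α q` removes one
      -- of these; the rest is free of `q`.
      ecc : ∀ q → eccentricity w xs R q ≡ accessibility G m q + C
      ecc q = begin
        ∑[ p ∈ xs ] (d p * R p q)
          ≡⟨ ∑-cong {xs = xs} (λ {p} _ → ≡.trans (cong (d p *_) (R≡ p q)) (alg₁ (d p) V⁻¹ (hitting p q) (α p) (α q))) ⟩
        ∑[ p ∈ xs ] (V⁻¹ * (2* (d p * hitting p q) + (d p * α p - d p * α q)))
          ≡⟨ ∑-* xs V⁻¹ (λ p → 2* (d p * hitting p q) + (d p * α p - d p * α q)) ⟩
        V⁻¹ * ∑[ p ∈ xs ] (2* (d p * hitting p q) + (d p * α p - d p * α q))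
          ≡⟨ cong (V⁻¹ *_) (≡.trans (∑-+ xs (λ p → 2* (d p * hitting p q)) (λ p → d p * α p - d p * α q))
               (cong₂ _+_ (∑-+ xs (λ p → d p * hitting p q) (λ p → d p * hitting p q))
                 (≡.trans (∑-- xs (λ p → d p * α p) (λ p → d p * α q)) (cong (λ s → ∑[ p ∈ xs ] (d p * α p) - s) (∑-*ʳ xs (α q) d))))) ⟩
        V⁻¹ * (2* total q + (∑[ p ∈ xs ] (d p * α p) - V * α q))
          ≡⟨ alg₂ V⁻¹ (total q) (∑[ p ∈ xs ] (d p * α p)) V ⟩
        2* α q - V * V⁻¹ * α q + C
          ≡⟨ cong (λ a → 2* α q - a * α q + C) V*V⁻¹ ⟩
        2* α q - 1ℚ * α q + C
          ≡⟨ cong (_+ C) (alg₃ (α q)) ⟩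
        α q + C
          ≡⟨ cong (_+ C) (accessibility≡ q) ⟨
        accessibility G m q + C ∎
        where
        alg₁ : ∀ d u h a b → d * (u * (h + h + a + - b)) ≡ u * (d * h + d * h + (d * a - d * b))
        alg₁ = solve-∀ ℚ-ring
        alg₂ : ∀ u t s v → u * (t + t + (s - v * (u * t))) ≡ u * t + u * t - v * u * (u * t) + u * s
        alg₂ = solve-∀ ℚ-ring
        alg₃ : ∀ a → a + a - 1ℚ * a ≡ a
        alg₃ = solve-∀ ℚ-ring

  resistance : ∃[ R ] (IsResistance w xs R ×
    (∀ {u v} → accessibility G m u ≤ accessibility G m v → eccentricity w xs R u ≤ eccentricity w xs R v))
  resistance = resistance′ (2 ℕ.* edges G) refl

-- Growing a tree

module Tree (T : Graph k) where
  open DecMembership (Fin._≟_ {k}) using (_∈?_)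

  -- A history of leaf additions, newest vertex first. The last argument of `sprout` says that the
  -- new vertex has a single neighbour among the earlier ones, so the chain grows by exactly one
  -- bridge.
  data Grown (r : Fin k) : List (Fin k) → Set where
    seed   : Grown r (r ∷ [])
    sprout : ∀ {L i p} → Grown r L → i ∉ L → p ∈ L → Adj T p i →
      (∀ {j} → j ∈ L → Adj T j i → j ≡ p) → Grown r (i ∷ L)

  -- Unlike `Star`, a route exposes the list of its vertices, in the form in which `Acyclic` speaks
  -- about cycles.
  data Route : Fin k → Fin k → List (Fin k) → Set where
    stay : ∀ {a} → Route a a (a ∷ [])
    step : ∀ {a b c zs} → Adj T a b → Route b c zs → Route a c (a ∷ zs)

  _▻_ : ∀ {a b c zs} → Route a b zs → Adj T b c → Route a c (zs ∷ʳ c)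
  stay         ▻ b∼c = step b∼c stay
  step a∼b rte ▻ b∼c = step a∼b (rte ▻ b∼c)

  linked : ∀ {a b zs} → Route a b zs → Linked (Adj T) zs
  linked stay                       = [-]
  linked (step a∼b stay)            = a∼b ∷ [-]
  linked (step a∼b (step b∼c rte))  = a∼b ∷ linked (step b∼c rte)

  module _ {r : Fin k} where

    root∈ : ∀ {L} → Grown r L → r ∈ L
    root∈ seed                 = here refl
    root∈ (sprout g _ _ _ _)   = there (root∈ g)

    grown-unique : ∀ {L} → Grown r L → Unique L
    grown-unique seed                  = [] ∷ []
    grown-unique (sprout g i∉L _ _ _)  = All.tabulate (λ { j∈L refl → i∉L j∈L }) ∷ grown-unique g

    size : ∀ {L} → Grown r L → ℕ
    size seed                 = 0
    size (sprout g _ _ _ _)   = suc (size g)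

    length-size : ∀ {L} (g : Grown r L) → length L ≡ suc (size g)
    length-size seed               = refl
    length-size (sprout g _ _ _ _) = cong suc (length-size g)

    -- The newest vertex is used only as an endpoint, entered through its parent, so the rest of the
    -- route stays in the older set and no vertex repeats.
    simple-route : ∀ {L a b} → Grown r L → a ∈ L → b ∈ L →
      ∃[ zs ] (Route a b zs × Unique zs × (∀ {x} → x ∈ zs → x ∈ L))
    simple-route seed (here refl) (here refl) = _ , stay , [] ∷ [] , id
    simple-route (sprout _ _ _ _ _) (here refl) (here refl) =
      _ , stay , [] ∷ [] , λ { (here refl) → here refl }
    simple-route (sprout g i∉L p∈L p∼i _) (here refl) (there b∈L) with simple-route g p∈L b∈L
    ... | zs , rte , u , zs⊆L = _ , step (adj-sym T p∼i) rte ,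
      All.tabulate (λ { x∈zs refl → i∉L (zs⊆L x∈zs) }) ∷ u ,
      λ { (here refl) → here refl ; (there x∈zs) → there (zs⊆L x∈zs) }
    simple-route {L} (sprout {i = i} g i∉L p∈L p∼i _) (there a∈L) (here refl) with simple-route g a∈L p∈L
    ... | zs , rte , u , zs⊆L = _ , rte ▻ p∼i ,
      Unique.++⁺ u ([] ∷ []) (λ { (x∈zs , here refl) → i∉L (zs⊆L x∈zs) }) ,
      λ x∈ → by (∈-++⁻ zs x∈)
      where
      by : ∀ {x} → x ∈ zs ⊎ x ∈ (i ∷ []) → x ∈ L
      by (inj₁ x∈zs)        = there (zs⊆L x∈zs)
      by (inj₂ (here refl)) = here refl
    simple-route (sprout g _ _ _ _) (there a∈L) (there b∈L) with simple-route g a∈L b∈L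
    ... | zs , rte , u , zs⊆L = zs , rte , u , there ∘ zs⊆L

    -- Two neighbours of i inside a grown set are joined there by a simple
    -- route, which i closes to a cycle.
    unique-parent : Acyclic T → ∀ {L i p q} → Grown r L → i ∉ L →
      p ∈ L → Adj T p i → q ∈ L → Adj T q i → q ≡ p
    unique-parent acyclic g i∉L p∈L p∼i q∈L q∼i with simple-route g q∈L p∈L
    ... | _ , stay , _ = refl
    -- This case and the next differ only in exposing enough of the list for the cycle to show its
    -- three leading vertices.
    ... | _ , rte@(step _ stay) , u , zs⊆L = ⊥-elim (acyclic _ _ _ _
      (All.tabulate (λ { x∈zs refl → i∉L (zs⊆L x∈zs) }) ∷ u)
      (linked (step (adj-sym T q∼i) (rte ▻ p∼i))))
    ... | _ , rte@(step _ (step _ _)) , u , zs⊆L = ⊥-elim (acyclic _ _ _ _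
      (All.tabulate (λ { x∈zs refl → i∉L (zs⊆L x∈zs) }) ∷ u)
      (linked (step (adj-sym T q∼i) (rte ▻ p∼i))))

    -- Along the path, each vertex not yet present is attached to its predecessor, which is already
    -- there.
    extend : Acyclic T → ∀ {L u j} → Grown r L → u ∈ L → Star (Adj T) u j →
      ∃[ L′ ] (Grown r L′ × (∀ {x} → x ∈ L → x ∈ L′) × j ∈ L′)
    extend acyclic g u∈L stop = _ , g , id , u∈L
    extend acyclic {L} g u∈L (_◅_ {j = l} u∼l l⋯j) with l ∈? L
    ... | yes l∈L = extend acyclic g l∈L l⋯j
    ... | no  l∉L with extend acyclic (sprout g l∉L u∈L u∼l (unique-parent acyclic g l∉L u∈L u∼l)) (here refl) l⋯j
    ...   | L′ , g′ , L⊆L′ , j∈L′ = L′ , g′ , L⊆L′ ∘ there , j∈L′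

  spanning : IsTree T → ∀ r → ∃[ L ] (Grown r L × Enumerates L)
  spanning (connected , acyclic) r with cover (allFin k)
    where
    cover : ∀ js → ∃[ L ] (Grown r L × (∀ {j} → j ∈ js → j ∈ L))
    cover [] = _ , seed , λ ()
    cover (j ∷ js) with cover js
    ... | L , g , js⊆L with extend acyclic g (root∈ g) (connected r j)
    ...   | L′ , g′ , L⊆L′ , j∈L′ = L′ , g′ , λ { (here refl) → j∈L′ ; (there j∈js) → L⊆L′ (js⊆L j∈js) }
  ... | L , g , covers = L , g , record { unique = grown-unique g ; complete = λ j → covers (∈-allFin j) }

  suc-size≡k : ∀ {r L} (g : Grown r L) → Enumerates L → suc (size g) ≡ k
  suc-size≡k g enum = ≡.trans (sym (length-size g))
    (≡.trans (↭-length (Enumerates.allFin↭ enum)) (List.length-tabulate id))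

-- Chains

𝟙-× : ∀ {P Q : Set} (d : Dec P) (e : Dec Q) → 𝟙 (d ×-dec e) ≡ 𝟙 d * 𝟙 e
𝟙-× (yes _) e = sym (ℚ.*-identityˡ (𝟙 e))
𝟙-× (no  _) e = sym (ℚ.*-zeroˡ (𝟙 e))

module Chain {k n} (T : Graph k) (e : Attachment k n) (H : Graph n) where
  open Tree T

  G : Graph (k ℕ.* n)
  G = chain T e H

  w : Weight (k ℕ.* n)
  w = weight G

  private
    Adjacent : Fin k × Fin n → Fin k × Fin n → Set
    Adjacent p q = SameCopy k H p q ⊎ Bridge T e p q

    at-combine : ∀ (i : Fin k) (x : Fin n) → remQuot n (combine i x) ≡ (i , x)
    at-combine = Fin.remQuot-combine

  adj-combine⁺ : ∀ {i x j y} → Adjacent (i , x) (j , y) → Adj G (combine i x) (combine j y)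
  adj-combine⁺ {i} {x} {j} {y} = subst₂ Adjacent (sym (at-combine i x)) (sym (at-combine j y))

  adj-combine⁻ : ∀ {i x j y} → Adj G (combine i x) (combine j y) → Adjacent (i , x) (j , y)
  adj-combine⁻ {i} {x} {j} {y} = subst₂ Adjacent (at-combine i x) (at-combine j y)

  connected : Connected T → Connected H → Connected G
  connected cT cH u v = subst₂ (Star (Adj G)) (Fin.combine-remQuot {k} n u) (Fin.combine-remQuot {k} n v)
      (across-tree (cT _ _) (proj₂ (remQuot {k} n u)))
    where
    within : ∀ i {x y} → Star (Adj H) x y → Star (Adj G) (combine i x) (combine i y)
    within i = Star.gmap (combine i) (λ xy → adj-combine⁺ (inj₁ (refl , xy)))
    across-tree : ∀ {i j} → Star (Adj T) i j → ∀ x {y} → Star (Adj G) (combine i x) (combine j y)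
    across-tree {i} stop x {y} = within i (cH x y)
    across-tree {i} (_◅_ {j = l} i∼l l⋯j) x =
      within i (cH x (e i l)) ◅◅ adj-combine⁺ (inj₂ (i∼l , refl , refl)) ◅ across-tree l⋯j (e l i)

  copy : Fin k → List (Fin (k ℕ.* n))
  copy i = tabulate (combine i)

  copies : List (Fin k) → List (Fin (k ℕ.* n))
  copies []      = []
  copies (i ∷ L) = copy i ++ copies L

  ∈-copies⁻ : ∀ {L p} → p ∈ copies L → ∃[ j ] (j ∈ L × ∃[ y ] (p ≡ combine j y))
  ∈-copies⁻ {i ∷ L} p∈ with ∈-++⁻ (copy i) p∈
  ... | inj₁ p∈copy = i , here refl , ∈-tabulate⁻ p∈copy
  ... | inj₂ p∈rest with ∈-copies⁻ p∈rest
  ...   | j , j∈L , y , p≡ = j , there j∈L , y , p≡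

  ∈-copies⁺ : ∀ {L j} → j ∈ L → ∀ y → combine j y ∈ copies L
  ∈-copies⁺ (here refl) y = ∈-++⁺ˡ (∈-tabulate⁺ y)
  ∈-copies⁺ {i ∷ L} (there j∈L) y = ∈-++⁺ʳ (copy i) (∈-copies⁺ j∈L y)

  copy-unique : ∀ i → Unique (copy i)
  copy-unique i = Unique.tabulate⁺ (λ {x} {y} → Fin.combine-injectiveʳ i x i y)

  copy-disjoint : ∀ {i L p} → i ∉ L → p ∈ copy i → p ∉ copies L
  copy-disjoint {i} i∉L p∈copy p∈copies with ∈-tabulate⁻ p∈copy | ∈-copies⁻ p∈copies
  ... | x , refl | j , j∈L , y , eq with Fin.combine-injectiveˡ i x j y eq
  ...   | refl = i∉L j∈L

  copies-unique : ∀ {L} → Unique L → Unique (copies L)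
  copies-unique []        = []
  copies-unique {i ∷ L} (i∉L ∷ u) = Unique.++⁺ (copy-unique i) (copies-unique u)
    (λ (p∈copy , p∈copies) → copy-disjoint {L = L} (λ i∈L → All.lookup i∉L i∈L refl) p∈copy p∈copies)

  copies-enumerates : ∀ {L} → Enumerates L → Enumerates (copies L)
  copies-enumerates {L} enum = record
    { unique   = copies-unique unique
    ; complete = λ p → subst (_∈ copies L) (Fin.combine-remQuot {k} n p)
        (∈-copies⁺ (complete (proj₁ (remQuot {k} n p))) (proj₂ (remQuot {k} n p))) }
    where open Enumerates enum

  -- Only bridges leave a copy, and `parent` leaves a single one between the new copy and the old
  -- ones.
  bridged : ∀ {L i p} → Unique L → i ∉ L → p ∈ L → Adj T p i → (∀ {j} → j ∈ L → Adj T j i → j ≡ p) →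
    Bridged w (copy i) (copies L) (combine i (e i p)) (combine p (e p i))
  bridged {L} {i} {p} u i∉L p∈L p∼i parent = record
    { unique-x = copy-unique i
    ; unique-y = copies-unique u
    ; p₀∈xs = ∈-tabulate⁺ (e i p)
    ; q₀∈ys = ∈-copies⁺ p∈L (e p i)
    ; disjoint = copy-disjoint i∉L
    ; cross = cross
    ; cross′ = λ {a} {b} a∈ b∈ → ≡.trans (weight-sym G b a) (≡.trans (cross a∈ b∈) (ℚ.*-comm (δ a p₀) (δ b q₀)))
    }
    where
    p₀ = combine i (e i p)
    q₀ = combine p (e p i)
    cross : ∀ {a b} → a ∈ copy i → b ∈ copies L → w a b ≡ δ a p₀ * δ b q₀
    cross a∈ b∈ with ∈-tabulate⁻ a∈ | ∈-copies⁻ b∈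
    ... | x , refl | j , j∈L , y , refl = ≡.trans
      (𝟙-cong to from (adj? G (combine i x) (combine j y)) ((combine i x Fin.≟ p₀) ×-dec (combine j y Fin.≟ q₀)))
      (𝟙-× (combine i x Fin.≟ p₀) (combine j y Fin.≟ q₀))
      where
      to : Adj G (combine i x) (combine j y) → combine i x ≡ p₀ × combine j y ≡ q₀
      to adj with adj-combine⁻ adj
      ... | inj₁ (refl , _) = contradiction j∈L i∉L
      ... | inj₂ (i∼j , refl , refl) with parent j∈L (adj-sym T i∼j)
      ...   | refl = refl , refl
      from : combine i x ≡ p₀ × combine j y ≡ q₀ → Adj G (combine i x) (combine j y)
      from (x≡ , y≡) = subst₂ (Adj G) (sym x≡) (sym y≡) (adj-combine⁺ (inj₂ (adj-sym T p∼i , refl , refl)))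

  private
    wH = weight H
    hs = allFin n

  weight-copy : ∀ (i : Fin k) (x y : Fin n) → w (combine i x) (combine i y) ≡ wH x y
  weight-copy i x y = 𝟙-cong to (λ xy → adj-combine⁺ (inj₁ (refl , xy)))
    (adj? G (combine i x) (combine i y)) (adj? H x y)
    where
    to : Adj G (combine i x) (combine i y) → Adj H x y
    to adj with adj-combine⁻ adj
    ... | inj₁ (_ , xy) = xy
    ... | inj₂ (i∼i , _) = contradiction i∼i (adj-irrefl T refl)

  ∑-copy : ∀ (i : Fin k) (f : Fin (k ℕ.* n) → ℚ) → ∑ (copy i) f ≡ ∑[ x ∈ hs ] f (combine i x)
  ∑-copy i f = ≡.trans (∑-tabulate (combine i) f) (sym (∑-tabulate id (f ∘ combine i)))

  ∑-copy-cong : ∀ (i : Fin k) {f : Fin (k ℕ.* n) → ℚ} {g : Fin n → ℚ} → (∀ x → f (combine i x) ≡ g x) → ∑ (copy i) f ≡ ∑ hs g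
  ∑-copy-cong i {f} f≡g = ≡.trans (∑-copy i f) (∑-cong {xs = hs} λ {x} _ → f≡g x)

  degree-copy : ∀ (i : Fin k) (x : Fin n) → degree w (copy i) (combine i x) ≡ degree wH hs x
  degree-copy i x = ∑-copy-cong i (λ y → weight-copy i x y)

  volume-copy : ∀ i → volume w (copy i) ≡ volume wH hs
  volume-copy i = ∑-copy-cong i (degree-copy i)

  module _ {R : Weight n} (res : IsResistance wH hs R) where
    open IsResistance res

    private
      part : Fin (k ℕ.* n) → Fin n
      part p = proj₂ (remQuot {k} n p)

      part-combine : ∀ (i : Fin k) x → part (combine i x) ≡ x
      part-combine i x = cong proj₂ (at-combine i x)

    -- The index of the copy is ignored, so one matrix serves all copies; it is a resistance only
    -- within each of them.
    lift : Weight (k ℕ.* n)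
    lift p q = R (part p) (part q)

    lift-combine : ∀ (i : Fin k) x (j : Fin k) y → lift (combine i x) (combine j y) ≡ R x y
    lift-combine i x j y = cong₂ R (part-combine i x) (part-combine j y)

    lift-resistance : ∀ i → IsResistance w (copy i) lift
    lift-resistance i = record
      { current = current ∘ part
      ; symmetric = λ p q → symmetric (part p) (part q)
      ; diagonal = λ p → diagonal (part p)
      ; 0≤R = λ p q → 0≤R (part p) (part q)
      ; kirchhoff = kirchhoff′ }
      where
      δ-combine : ∀ (x y : Fin n) → δ (combine i x) (combine i y) ≡ δ x y
      δ-combine x y = 𝟙-cong (Fin.combine-injectiveʳ i x i y) (cong (combine i)) (combine i x Fin.≟ combine i y) (x Fin.≟ y)
      kirchhoff′ : ∀ {p q} → p ∈ copy i → q ∈ copy i →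
        lap w (copy i) (λ l → lift l q) p ≡ current (part p) - 2* δ p q
      kirchhoff′ p∈ q∈ with ∈-tabulate⁻ p∈ | ∈-tabulate⁻ q∈
      ... | x , refl | y , refl = begin
        lap w (copy i) (λ l → lift l (combine i y)) (combine i x)
          ≡⟨ ∑-copy-cong i (λ z → cong₂ _*_ (weight-copy i x z) (cong₂ _-_ (lift-combine i x i y) (lift-combine i z i y))) ⟩
        lap wH hs (λ l → R l y) x
          ≡⟨ kirchhoff (∈-allFin x) (∈-allFin y) ⟩
        current x - 2* δ x y
          ≡⟨ cong₂ (λ a b → current a - 2* b) (part-combine i x) (δ-combine x y) ⟨
        current (part (combine i x)) - 2* δ (combine i x) (combine i y) ∎
        where open ≡-Reasoning

    eccentricity-copy : ∀ (i : Fin k) (x : Fin n) → eccentricity w (copy i) lift (combine i x) ≡ eccentricity wH hs R x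
    eccentricity-copy i x = ∑-copy-cong i (λ z → cong₂ _*_ (degree-copy i z) (lift-combine i z i x))

    energy-copy : ∀ i → energy w (copy i) lift ≡ energy wH hs R
    energy-copy i = ∑-copy-cong i (λ z → cong₂ _*_ (degree-copy i z) (eccentricity-copy i z))

-- The optimal chain

-- The volume, minimal eccentricity and minimal energy of a chain of m + 1
-- copies of a graph with volume V and energy W whose vertices have
-- eccentricity at least E; see `volume-bridge` etc. for the recursion.
module Optimum (V E W : ℚ) where

  volume* : ℕ → ℚ
  volume* zero    = V
  volume* (suc m) = V + volume* m + 2* 1ℚ

  ecc* : ℕ → ℚ
  ecc* zero    = E
  ecc* (suc m) = E + (ecc* m + V + 1ℚ)

  energy* : ℕ → ℚ
  energy* zero    = W
  energy* (suc m) = W + energy* m +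
    2* ((volume* m + 2* 1ℚ) * E + (V + 2* 1ℚ) * ecc* m + (V + 1ℚ) * (volume* m + 1ℚ))

  V≤volume* : 0ℚ ≤ V → ∀ m → V ≤ volume* m
  V≤volume* 0≤V zero    = ℚ.≤-refl
  V≤volume* 0≤V (suc m) = begin
    V                           ≡⟨ alg V ⟩
    V + 0ℚ + 2* 0ℚ              ≤⟨ ℚ.+-mono-≤ (ℚ.+-monoʳ-≤ V (ℚ.≤-trans 0≤V (V≤volume* 0≤V m))) (ℚ.+-mono-≤ 0≤1 0≤1) ⟩
    V + volume* m + 2* 1ℚ       ∎
    where
    open ≤-Reasoning
    alg : ∀ v → v ≡ v + 0ℚ + (0ℚ + 0ℚ)
    alg = solve-∀ ℚ-ring

-- Bounds and equality cases concern the same `R` and are therefore carried through one induction.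
-- `c` is the vertex at which the eccentricity bound must be attained for the next bridge to attain
-- its own bound.
record Bounds {N} (w : Weight N) (xs : List (Fin N)) (V* E* W* : ℚ) (Tight : Set) (c : Fin N) : Set where
  field
    R         : Weight N
    res       : IsResistance w xs R
    volume≡   : volume w xs ≡ V*
    ecc≥      : ∀ {q} → q ∈ xs → E* ≤ eccentricity w xs R q
    energy≥   : W* ≤ energy w xs R
    ecc≡      : Tight → eccentricity w xs R c ≡ E*
    energy≡   : Tight → energy w xs R ≡ W*

module ChainBounds {k n} (T : Graph k) (e : Attachment k n) (H : Graph n)
  {R₁ : Weight n} (res₁ : IsResistance (weight H) (allFin n) R₁)
  (v : Fin n) (ecc-min : ∀ x → eccentricity (weight H) (allFin n) R₁ v ≤ eccentricity (weight H) (allFin n) R₁ x)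
  (r : Fin k) where
  open Chain T e H
  open Tree T

  private
    hs = allFin n
    V = volume (weight H) hs
    E = eccentricity (weight H) hs R₁ v
    W = energy (weight H) hs R₁

  open Optimum V E W public

  Tight : Set
  Tight = (∀ {i j} → Adj T i j → e i j ≡ v) × (∀ j → j ≢ r → Adj T r j)

  0≤V : 0ℚ ≤ V
  0≤V = ∑-nonNeg {xs = hs} λ {i} _ → ∑-nonNeg {xs = hs} λ {l} _ → 0≤𝟙 (adj? H i l)

  private
    ecc-copy≥ : ∀ i {q} → q ∈ copy i → E ≤ eccentricity w (copy i) (lift res₁) q
    ecc-copy≥ i q∈ with ∈-tabulate⁻ q∈
    ... | x , refl = subst (E ≤_) (sym (eccentricity-copy res₁ i x)) (ecc-min x)

    Bounded : List (Fin (k ℕ.* n)) → ℕ → Set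
    Bounded xs m = Bounds w xs (volume* m) (ecc* m) (energy* m) Tight (combine r v)

  bounds : ∀ {L} (g : Grown r L) → Bounded (copies L) (size g)
  bounds seed = subst (λ xs → Bounded xs 0) (sym (List.++-identityʳ (copy r))) (record
    { R       = lift res₁
    ; res     = lift-resistance res₁ r
    ; volume≡ = volume-copy r
    ; ecc≥    = ecc-copy≥ r
    ; energy≥ = ℚ.≤-reflexive (sym (energy-copy res₁ r))
    ; ecc≡    = λ _ → eccentricity-copy res₁ r v
    ; energy≡ = λ _ → energy-copy res₁ r })
  bounds {i ∷ L} (sprout {p = p} g i∉L p∈L p∼i parent) = record
    { R       = J
    ; res     = isResistance
    ; volume≡ = ≡.trans volume-bridge (cong₂ (λ a b → a + b + 2* 1ℚ) (volume-copy i) B.volume≡)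
    ; ecc≥    = λ q∈ → ecc≥′ (∈-++⁻ (copy i) q∈)
    ; energy≥ = energy≥′
    ; ecc≡    = ecc≡′
    ; energy≡ = energy≡′ }
    where
    module B = Bounds (bounds g)
    new = copy i
    old = copies L
    p₀ = combine i (e i p)
    q₀ = combine p (e p i)
    b : Bridged w new old p₀ q₀
    b = bridged (grown-unique g) i∉L p∈L p∼i parent
    open Bridge b (lift-resistance res₁ i) B.res
    open Bridged b using (p₀∈xs; q₀∈ys)
    module R₂ = IsResistance B.res
    module L₁ = IsResistance (lift-resistance res₁ i)

    m = size g
    e₁ = eccentricity w new (lift res₁)
    e₂ = eccentricity w old B.R
    V₂ = volume* m

    V≤V₂ : V ≤ V₂
    V≤V₂ = V≤volume* 0≤V m
    0≤V₂ : 0ℚ ≤ V₂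
    0≤V₂ = ℚ.≤-trans 0≤V V≤V₂
    0≤2 : 0ℚ ≤ 2* 1ℚ
    0≤2 = +-nonNeg 0≤1 0≤1

    -- Covers both positions of `q`. The volume beyond the bridge is that of the old part for a new
    -- vertex and `V` for an old one; `V` is the smaller, hence its appearance in `ecc*`.
    ecc≥-general : ∀ {E₁ E₂ u u′ s} → E ≤ E₁ → ecc* m ≤ E₂ → 0ℚ ≤ u → 0ℚ ≤ s → V ≤ u′ →
      ecc* (suc m) ≤ E₁ + (u + 2* 1ℚ) * s + (E₂ + u′ + 1ℚ)
    ecc≥-general {E₁} {E₂} {u} {u′} {s} E≤ E*≤ 0≤u 0≤s V≤u′ = begin
      E + (ecc* m + V + 1ℚ)
        ≡⟨ cong (_+ (ecc* m + V + 1ℚ)) (ℚ.+-identityʳ E) ⟨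
      E + 0ℚ + (ecc* m + V + 1ℚ)
        ≤⟨ ℚ.+-mono-≤ (ℚ.+-mono-≤ E≤ (*-nonNeg (+-nonNeg 0≤u 0≤2) 0≤s)) (ℚ.+-monoˡ-≤ 1ℚ (ℚ.+-mono-≤ E*≤ V≤u′)) ⟩
      E₁ + (u + 2* 1ℚ) * s + (E₂ + u′ + 1ℚ) ∎
      where open ≤-Reasoning

    ecc≥′ : ∀ {q} → q ∈ new ⊎ q ∈ old → ecc* (suc m) ≤ eccentricity w (new ++ old) J q
    ecc≥′ {q} (inj₁ q∈new) = subst (ecc* (suc m) ≤_) (sym (eccentricity-bridgeˡ q∈new))
      (ecc≥-general (ecc-copy≥ i q∈new) (B.ecc≥ q₀∈ys)
        (subst (0ℚ ≤_) (sym B.volume≡) 0≤V₂) (L₁.0≤R p₀ q) (subst (V ≤_) (sym B.volume≡) V≤V₂))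
    ecc≥′ {q} (inj₂ q∈old) = subst (ecc* (suc m) ≤_)
      (≡.trans (alg (e₁ p₀) (e₂ q) ((volume w new + 2* 1ℚ) * B.R q₀ q) (volume w new)) (sym (eccentricity-bridgeʳ q∈old)))
      (ecc≥-general (ecc-copy≥ i p₀∈xs) (B.ecc≥ q∈old)
        (subst (0ℚ ≤_) (sym (volume-copy i)) 0≤V) (R₂.0≤R q₀ q) (ℚ.≤-reflexive (sym (volume-copy i))))
      where
      alg : ∀ a b c v → a + c + (b + v + 1ℚ) ≡ b + c + (a + v + 1ℚ)
      alg = solve-∀ ℚ-ring

    energy-formula : ∀ {v₁ v₂} → volume w new ≡ v₁ → volume w old ≡ v₂ → energy w (new ++ old) J ≡
      W + energy w old B.R + 2* ((v₂ + 2* 1ℚ) * e₁ p₀ + (v₁ + 2* 1ℚ) * e₂ q₀ + (v₁ + 1ℚ) * (v₂ + 1ℚ))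
    energy-formula refl refl = ≡.trans energy-bridge (cong (λ a → a + energy w old B.R +
        2* ((volume w old + 2* 1ℚ) * e₁ p₀ + (volume w new + 2* 1ℚ) * e₂ q₀ + (volume w new + 1ℚ) * (volume w old + 1ℚ))) (energy-copy res₁ i))

    energy≥′ : energy* (suc m) ≤ energy w (new ++ old) J
    energy≥′ = subst (energy* (suc m) ≤_) (sym (energy-formula (volume-copy i) B.volume≡))
      (ℚ.+-mono-≤ (ℚ.+-monoʳ-≤ W B.energy≥) (ℚ.+-mono-≤ cross≤ cross≤))
      where
      cross≤ : (V₂ + 2* 1ℚ) * E + (V + 2* 1ℚ) * ecc* m + (V + 1ℚ) * (V₂ + 1ℚ) ≤
        (V₂ + 2* 1ℚ) * e₁ p₀ + (V + 2* 1ℚ) * e₂ q₀ + (V + 1ℚ) * (V₂ + 1ℚ)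
      cross≤ = ℚ.+-monoˡ-≤ ((V + 1ℚ) * (V₂ + 1ℚ)) (ℚ.+-mono-≤
        (*-monoˡ (+-nonNeg 0≤V₂ 0≤2) (ecc-copy≥ i p₀∈xs))
        (*-monoˡ (+-nonNeg 0≤V 0≤2) (B.ecc≥ q₀∈ys)))

    -- The centre is present from the start and adjacent to `i`, so it is the only possible parent.
    p≡r : Tight → p ≡ r
    p≡r (_ , centre) = sym (parent (root∈ g) (centre i (λ { refl → i∉L (root∈ g) })))

    e₁-tight : Tight → e₁ p₀ ≡ E
    e₁-tight (at-v , _) = ≡.trans (cong (e₁ ∘ combine i) (at-v (adj-sym T p∼i))) (eccentricity-copy res₁ i v)

    q₀-tight : Tight → q₀ ≡ combine r v
    q₀-tight t = cong₂ combine (p≡r t) (proj₁ t p∼i)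

    e₂-tight : Tight → e₂ q₀ ≡ ecc* m
    e₂-tight t = ≡.trans (cong e₂ (q₀-tight t)) (B.ecc≡ t)

    -- The new copy is attached at the tight vertex itself, so the term in `B.R q₀ q₀` vanishes and
    -- the same vertex stays tight.
    ecc≡′ : Tight → eccentricity w (new ++ old) J (combine r v) ≡ ecc* (suc m)
    ecc≡′ t = begin
      eccentricity w (new ++ old) J (combine r v)
        ≡⟨ cong (eccentricity w (new ++ old) J) (q₀-tight t) ⟨
      eccentricity w (new ++ old) J q₀
        ≡⟨ eccentricity-bridgeʳ q₀∈ys ⟩
      e₂ q₀ + (volume w new + 2* 1ℚ) * B.R q₀ q₀ + (e₁ p₀ + volume w new + 1ℚ)
        ≡⟨ cong (λ s → e₂ q₀ + (volume w new + 2* 1ℚ) * s + (e₁ p₀ + volume w new + 1ℚ)) (R₂.diagonal q₀) ⟩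
      e₂ q₀ + (volume w new + 2* 1ℚ) * 0ℚ + (e₁ p₀ + volume w new + 1ℚ)
        ≡⟨ alg (e₂ q₀) (volume w new + 2* 1ℚ) (e₁ p₀) (volume w new) ⟩
      e₁ p₀ + (e₂ q₀ + volume w new + 1ℚ)
        ≡⟨ cong₂ (λ a b → a + (b + volume w new + 1ℚ)) (e₁-tight t) (e₂-tight t) ⟩
      E + (ecc* m + volume w new + 1ℚ)
        ≡⟨ cong (λ a → E + (ecc* m + a + 1ℚ)) (volume-copy i) ⟩
      E + (ecc* m + V + 1ℚ) ∎
      where
      open ≡-Reasoning
      alg : ∀ a u b v → a + u * 0ℚ + (b + v + 1ℚ) ≡ b + (a + v + 1ℚ)
      alg = solve-∀ ℚ-ring

    energy≡′ : Tight → energy w (new ++ old) J ≡ energy* (suc m)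
    energy≡′ t = ≡.trans (energy-formula (volume-copy i) B.volume≡)
      (cong₂ _+_ (cong (W +_) (B.energy≡ t))
        (cong 2*_ (cong₂ (λ a b → (V₂ + 2* 1ℚ) * a + (V + 2* 1ℚ) * b + (V + 1ℚ) * (V₂ + 1ℚ)) (e₁-tight t) (e₂-tight t))))

  -- The right-hand values depend on the tree only through the number `m + 1` of copies, which makes
  -- two chains comparable.
  record Extremal (m : ℕ) : Set where
    field
      volume≡ : ι (2 ℕ.* edges G) ≡ volume* m
      kemeny≥ : (mG : MeanFirstPassage G) → ∀ i → (1 ÷ (2 ℕ.* edges G)) * energy* m ≤ 2* kemeny G mG i
      kemeny≡ : Tight → (mG : MeanFirstPassage G) → ∀ i → 2* kemeny G mG i ≡ (1 ÷ (2 ℕ.* edges G)) * energy* m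

  extremal : MeanFirstPassage G → Connected H → IsTree T → Extremal (ℕ.pred k)
  extremal mG₀ connected-H tree@(connected-T , _) with spanning tree r
  ... | L , g , enum = subst Extremal (cong ℕ.pred (suc-size≡k g enum)) (record
    { volume≡ = ≡.trans (Kemeny.handshake G connected-G enum′ mG₀) B.volume≡
    ; kemeny≥ = λ mG i → subst ((1 ÷ (2 ℕ.* edges G)) * energy* (size g) ≤_) (sym (Kemeny.kemeny-energy G connected-G enum′ mG B.res i))
        (*-monoˡ (0≤÷ 1 (2 ℕ.* edges G)) B.energy≥)
    ; kemeny≡ = λ t mG i → ≡.trans (Kemeny.kemeny-energy G connected-G enum′ mG B.res i)
        (cong ((1 ÷ (2 ℕ.* edges G)) *_) (B.energy≡ t)) })
    where
    module B = Bounds (bounds g)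
    connected-G = connected connected-T connected-H
    enum′ = copies-enumerates enum

-- Comparing the star with an arbitrary chain

2*-cancel-≤ : ∀ {a b} → 2* a ≤ 2* b → a ≤ b
2*-cancel-≤ 2a≤2b = ℚ.≮⇒≥ λ b<a → ℚ.<-irrefl refl (ℚ.<-≤-trans (ℚ.+-mono-< b<a b<a) 2a≤2b)

proposition3p21 : ∀ {k n : ℕ} → 2 ℕ.≤ k →
    (H : Graph n) → Connected H → (mH : MeanFirstPassage H) →
    (v : Fin n) → (∀ w → accessibility H mH v ≤ accessibility H mH w) →
    (S : Graph k) → IsStarTree S → (a : Attachment k n) →
    (∀ p q → Bridge S a p q → proj₂ p ≡ v × proj₂ q ≡ v) →
    (T : Graph k) → IsTree T → (e : Attachment k n) →
    (m* : MeanFirstPassage (chain S a H)) (m : MeanFirstPassage (chain T e H)) →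
    ∀ i j → kemeny (chain S a H) m* i ≤ kemeny (chain T e H) m j
proposition3p21 {k} {n} _ H connected-H mH v v-min S (tree-S , c , centre) a at-v T tree-T e m* m i j =
  2*-cancel-≤ (subst (_≤ 2* kemeny (chain T e H) m j)
    (≡.trans (cong (λ s → (1 ÷ s) * energy* (ℕ.pred k)) same-edges) (sym (Best.kemeny≡ (tight , centre) m* i)))
    (Any.kemeny≥ m j))
  where
  w = weight H
  resistance = Kemeny.resistance H connected-H (allFin-enumerates n) mH
  R = proj₁ resistance
  res = proj₁ (proj₂ resistance)
  open Optimum (volume w (allFin n)) (eccentricity w (allFin n) R v) (energy w (allFin n) R)

  ecc-min : ∀ x → eccentricity w (allFin n) R v ≤ eccentricity w (allFin n) R x
  ecc-min x = proj₂ (proj₂ resistance) (v-min x)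

  module Best = ChainBounds.Extremal (ChainBounds.extremal S a H res v ecc-min c m* connected-H tree-S)
  -- The centre `c` of the star `S` here serves as the root from which `T` is grown.
  module Any  = ChainBounds.Extremal (ChainBounds.extremal T e H res v ecc-min c m connected-H tree-T)

  tight : ∀ {i j} → Adj S i j → a i j ≡ v
  tight {i} {j} i∼j = proj₁ (at-v (i , a i j) (j , a j i) (i∼j , refl , refl))

  -- Both volumes equal `volume* (ℕ.pred k)`, so the energies of the two chains are divided by the
  -- same number.
  same-edges : 2 ℕ.* edges (chain T e H) ≡ 2 ℕ.* edges (chain S a H)
  same-edges = ι-injective {2 ℕ.* edges (chain T e H)} {2 ℕ.* edges (chain S a H)}
    (≡.trans Any.volume≡ (sym Best.volume≡))
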